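{- Let $n$ be a positive odd integer and let $p$ be a prime such that $p>n+1$. (i) If $\{a_k\}_{k\ge 0}\in\mathcal{S}_{ - }$ is a sequence of rational numbers such that $a_0,\dots,a_{p-1}$ are $p$-integral, then $$\sum_{0<k_1<\cdots<k_{n}<p}\frac{a_{p-k_n}}{k_1\cdots k_{n}}\equiv \sum_{0<k_1<\cdots<k_{n}<p}\frac{a_{k_1}}{k_1\cdots k_{n}}\equiv 0 \pmod{p}.$$ (ii) If $\{a_k\}_{k\ge 0}\in\mathcal{S}_{+}$ is a sequence of rational numbers such that $a_0,\dots,a_{p-2}$ are $p$-integral, then $$\sum_{0<k_1<\cdots<k_{n}<p}\frac{a_{p-k_n-1}}{k_1\cdots k_{n-1}}\equiv \sum_{0<k_1<\cdots<k_{n}<p}\frac{a_{k_1-1}}{k_2\cdots k_{n}}\equiv 0 \pmod{p}.$$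
   Context: $\mathcal{S}_{+}$ (respectively $\mathcal{S}_{ - }$) denotes the set of sequences $\{a_k\}_{k\ge 0}$ satisfying $\sum_{k=0}^{r}\binom{r}{k}(-1)^k a_k=a_r$ (respectively $=-a_r$) for all integers $r\ge 0$, i.e. the eigenspaces for the eigenvalues $1$ and $-1$ of the binomial transform. The sums run over integers $k_1<\cdots<k_n$ in the indicated range; for $n=1$ the empty products $k_1\cdots k_{n-1}$ and $k_2\cdots k_n$ equal $1$. A rational number is $p$-integral if its denominator is not divisible by $p$. For $p$-integral rationals $x,y$, $x\equiv y\pmod p$ means that $(x-y)/p$ is $p$-integral. -}

module Defs where

open import Data.Nat.Base as ℕ using (ℕ; zero; suc; _∸_)
open import Data.Nat.Combinatorics using (_C_)
open import Data.Nat.Divisibility using (_∣_)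
open import Data.Fin.Base using (toℕ)
open import Data.Integer.Base using (+_)
open import Data.Rational.Base using (ℚ; 0ℚ; 1ℚ; _+_; _*_; _-_; -_; _/_; ↧ₙ_; +-*-rawSemiring)
open import Data.Rational.Properties using (+-0-commutativeMonoid)
open import Data.Vec.Base using (Vec; []; _∷_; foldr′)
open import Relation.Nullary.Negation using (¬_)
open import Relation.Binary.PropositionalEquality using (_≡_)
open import Algebra.Definitions.RawSemiring +-*-rawSemiring using (_^_)
open import Algebra.Properties.CommutativeMonoid.Sum +-0-commutativeMonoid using (sum-syntax)

binomialTransform : (ℕ → ℚ) → ℕ → ℚ
binomialTransform a r =
  ∑[ k < suc r ] ((+ (r C toℕ k) / 1) * (- 1ℚ) ^ toℕ k * a (toℕ k))

𝒮₊ : (ℕ → ℚ) → Set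
𝒮₊ a = ∀ r → binomialTransform a r ≡ a r

𝒮₋ : (ℕ → ℚ) → Set
𝒮₋ a = ∀ r → binomialTransform a r ≡ - a r

-- Division of a rational by a natural number.  The value at the divisor 0 is
-- a convention; every divisor below is a product of positive integers or a
-- prime.
infixl 7 _/ₙ_
_/ₙ_ : ℚ → ℕ → ℚ
x /ₙ zero      = 0ℚ
x /ₙ d@(suc _) = x * (+ 1 / d)

-- ↧ₙ is the denominator in lowest terms.
_-integral_ : ℕ → ℚ → Set
p -integral x = ¬ (p ∣ ↧ₙ x)

infix 4 _≡_[mod_]
_≡_[mod_] : ℚ → ℚ → ℕ → Set
x ≡ y [mod p ] = p -integral ((x - y) /ₙ p)

∏ : ∀ {n} → Vec ℕ n → ℕ
∏ = foldr′ ℕ._*_ 1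

-- The sum of f k over lo < k < hi, with k written as lo + 1 + i.
sumBetween : (lo hi : ℕ) → (ℕ → ℚ) → ℚ
sumBetween lo hi f = ∑[ i < hi ∸ suc lo ] f (suc lo ℕ.+ toℕ i)

-- The sum of F (k₁ ∷ … ∷ kₙ ∷ []) over lo < k₁ < ⋯ < kₙ < hi, as the iterated
-- sum in which each index ranges strictly between its predecessor and hi.
sumIncreasing : (n lo hi : ℕ) → (Vec ℕ n → ℚ) → ℚ
sumIncreasing zero    lo hi F = F []
sumIncreasing (suc n) lo hi F =
  sumBetween lo hi λ k → sumIncreasing n k hi λ ks → F (k ∷ ks)

{-# OPTIONS --safe #-}

-- Regard a sequence a as the linear functional xᵏ ↦ aₖ on polynomials.  Then 𝒮₊
-- consists of the functionals invariant under x ↦ 1 − x.  In part (ii) the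
-- functional is applied to
--   Qₙ(x) = ∑_{0<k₁<⋯<kₙ<p} x^(k₁−1) / (k₂⋯kₙ),
-- and modulo p one has (x(x − 1)Qₙ₊₁)′ = Qₙ up to the constant coefficient, with
-- Q₀ = 0.  By induction on n this gives Qₙ(1 − x) = (−1)ⁿ Qₙ(x), so for odd n
-- every functional in 𝒮₊ kills Qₙ.  The sum over a_{p−kₙ−1} is the same one
-- after kᵢ ↦ p − k_{n+1−i}.  Part (i) is part (ii) for the sequence
-- a_{j+1}/(j+1), which lies in 𝒮₊ when a lies in 𝒮₋.
module Submission where

open import Defs
open import Algebra.Bundles using (CommutativeRing)
open import Data.Fin.Base using (toℕ)
open import Data.Fin.Permutation using (reverse)
open import Data.Fin.Properties using (opposite-prop; toℕ<n)
import Data.Integer.Base as ℤ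
open import Data.Integer.GCD using (gcd)
import Data.Integer.Properties as ℤ
open import Data.Nat.Base as ℕ using (ℕ; zero; suc; _≤_; _<_; _∸_; _⊓_; z≤n; s≤s)
open import Data.Nat.Combinatorics using (_C_; nCn≡1; nC1≡n; nCk+nC[k+1]≡[n+1]C[k+1])
open import Data.Nat.Combinatorics.Specification using (k>n⇒nCk≡0)
open import Data.Nat.Divisibility using (_∣_; ∣-trans; ∣-refl; m∣m*n; ∣m∣n⇒∣m+n; ∣1⇒≡1; >⇒∤)
open import Data.Nat.Primality using (Prime; euclidsLemma; ¬prime[1]; prime⇒irreducible)
import Data.Nat.Properties as ℕ
import Data.Rational.Unnormalised.Base as ℚᵘ
import Data.Rational.Unnormalised.Properties as ℚᵘ
open import Data.Sum.Base using ([_,_]′)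
open import Data.Vec.Base using (Vec; []; _∷_; _∷ʳ_; head; tail; init; last; initLast)
open import Data.Vec.Properties using (init-∷ʳ; last-∷ʳ)
open import Level using (0ℓ)
open import Relation.Binary.PropositionalEquality as ≡ using (_≡_)
open import Relation.Nullary.Negation using (¬_; contradiction)

-- The derivative identity can be integrated because of characteristic p. Put M = p - 2, the largest
-- degree in Qₙ. Comparing coefficients of x^(k+1) gives (k + 2)(Qₙ₊₁[k] - Qₙ₊₁[k+1]) = Qₙ[k+1] for
-- k < M, and there k + 2 is invertible modulo p; at k = M the derivative contributes p times the
-- top coefficient, which is 0. Hence Qₙ₊₁ is determined from its top coefficient downwards. The
-- polynomial (-1)ⁿ⁺¹ Qₙ₊₁(1 - x) obeys the same recursion, so only top coefficients have to be
-- compared: they vanish from Q₂ on, and for Q₁ = 1 + x + ⋯ + x^M the sign is right because p is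
-- odd. The constant coefficient of Qₙ never enters, since binomial moments of index at least 1
-- ignore it. Oddness of p is used once more at the end, to pass from 2U = 0 to U = 0.

-- Absorption identities for binomial coefficients

[1+k]*[1+n]C[1+k]≡[1+n]*nCk : ∀ n k → suc k ℕ.* (suc n C suc k) ≡ suc n ℕ.* (n C k)
[1+k]*[1+n]C[1+k]≡[1+n]*nCk n zero = ≡.trans (ℕ.*-identityˡ (suc n C 1))
  (≡.trans (nC1≡n (suc n)) (≡.sym (ℕ.*-identityʳ (suc n))))
[1+k]*[1+n]C[1+k]≡[1+n]*nCk zero (suc k) = ℕ.*-zeroʳ (suc (suc k))
[1+k]*[1+n]C[1+k]≡[1+n]*nCk (suc n) (suc k) = begin
  (2 ℕ.+ k) ℕ.* (suc (suc n) C suc (suc k))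
    ≡⟨ ≡.cong ((2 ℕ.+ k) ℕ.*_) (nCk+nC[k+1]≡[n+1]C[k+1] (suc n) (suc k)) ⟨
  (2 ℕ.+ k) ℕ.* (c ℕ.+ (suc n C suc (suc k)))
    ≡⟨ ℕ.*-distribˡ-+ (2 ℕ.+ k) c _ ⟩
  (c ℕ.+ suc k ℕ.* c) ℕ.+ (2 ℕ.+ k) ℕ.* (suc n C suc (suc k))
    ≡⟨ ≡.cong₂ (λ x y → (c ℕ.+ x) ℕ.+ y) ([1+k]*[1+n]C[1+k]≡[1+n]*nCk n k)
         ([1+k]*[1+n]C[1+k]≡[1+n]*nCk n (suc k)) ⟩
  (c ℕ.+ suc n ℕ.* (n C k)) ℕ.+ suc n ℕ.* (n C suc k)
    ≡⟨ ℕ.+-assoc c _ _ ⟩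
  c ℕ.+ (suc n ℕ.* (n C k) ℕ.+ suc n ℕ.* (n C suc k))
    ≡⟨ ≡.cong (c ℕ.+_) (ℕ.*-distribˡ-+ (suc n) (n C k) _) ⟨
  c ℕ.+ suc n ℕ.* (n C k ℕ.+ n C suc k)
    ≡⟨ ≡.cong (λ x → c ℕ.+ suc n ℕ.* x) (nCk+nC[k+1]≡[n+1]C[k+1] n k) ⟩
  suc (suc n) ℕ.* c ∎
  where
  open ≡.≡-Reasoning
  c = suc n C suc k

-- A telescoping identity without subtraction: `suc k * (suc n C k)` is the increment in n of
-- `suc n * (n C k)`. This drives the summation by parts below.
[1+n]*nCk+[1+k]*[1+n]Ck≡[2+n]*[1+n]Ck : ∀ n k →
  suc n ℕ.* (n C k) ℕ.+ suc k ℕ.* (suc n C k) ≡ suc (suc n) ℕ.* (suc n C k)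
[1+n]*nCk+[1+k]*[1+n]Ck≡[2+n]*[1+n]Ck n k = begin
  suc n ℕ.* (n C k) ℕ.+ suc k ℕ.* (suc n C k)
    ≡⟨ ≡.cong (ℕ._+ suc k ℕ.* (suc n C k)) ([1+k]*[1+n]C[1+k]≡[1+n]*nCk n k) ⟨
  suc k ℕ.* (suc n C suc k) ℕ.+ suc k ℕ.* (suc n C k)
    ≡⟨ ℕ.*-distribˡ-+ (suc k) (suc n C suc k) _ ⟨
  suc k ℕ.* (suc n C suc k ℕ.+ suc n C k)
    ≡⟨ ≡.cong (suc k ℕ.*_) (ℕ.+-comm (suc n C suc k) _) ⟩
  suc k ℕ.* (suc n C k ℕ.+ suc n C suc k)
    ≡⟨ ≡.cong (suc k ℕ.*_) (nCk+nC[k+1]≡[n+1]C[k+1] (suc n) k) ⟩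
  suc k ℕ.* (suc (suc n) C suc k)
    ≡⟨ [1+k]*[1+n]C[1+k]≡[1+n]*nCk (suc n) k ⟩
  suc (suc n) ℕ.* (suc n C k) ∎
  where open ≡.≡-Reasoning

-- Finite sums and binomial moments over a commutative ring

module CommutativeRingSums {c ℓ} (R : CommutativeRing c ℓ) where
  open CommutativeRing R
  open import Algebra.Properties.Semiring.Sum semiring public
  open import Algebra.Properties.Semiring.Mult semiring
  open import Algebra.Properties.Semiring.Exp semiring using (_^_; ^-homo-*)
  open import Algebra.Properties.AbelianGroup +-abelianGroup using () renaming (∙-cancelʳ to +-cancelʳ)
  open import Algebra.Solver.Ring.NaturalCoefficients.Default commutativeSemiring using (solve; con; _:=_; _:+_; _:*_)
  open import Relation.Binary.Reasoning.Setoid setoid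

  ⟦_⟧ : ℕ → Carrier
  ⟦ n ⟧ = n × 1#

  ⟦⟧-homo-+ : ∀ m n → ⟦ m ℕ.+ n ⟧ ≈ ⟦ m ⟧ + ⟦ n ⟧
  ⟦⟧-homo-+ = ×-homo-+ 1#

  ⟦⟧-homo-* : ∀ m n → ⟦ m ℕ.* n ⟧ ≈ ⟦ m ⟧ * ⟦ n ⟧
  ⟦⟧-homo-* = ×1-homo-*

  sg : ℕ → Carrier
  sg k = (- 1#) ^ k

  ∑-cong : ∀ (f g : ℕ → Carrier) n → (∀ i → i < n → f i ≈ g i) →
    ∑[ i < n ] f (toℕ i) ≈ ∑[ i < n ] g (toℕ i)
  ∑-cong f g n f≈g = sum-cong-≋ (λ i → f≈g (toℕ i) (toℕ<n i))

  ∑-last : ∀ (f : ℕ → Carrier) n →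
    ∑[ i < suc n ] f (toℕ i) ≈ ∑[ i < n ] f (toℕ i) + f n
  ∑-last f zero = trans (+-identityʳ (f 0)) (sym (+-identityˡ (f 0)))
  ∑-last f (suc n) = trans (+-congˡ (∑-last (λ i → f (suc i)) n)) (sym (+-assoc _ _ _))

  ∑-zero : ∀ (f : ℕ → Carrier) n → (∀ i → i < n → f i ≈ 0#) → ∑[ i < n ] f (toℕ i) ≈ 0#
  ∑-zero f n f≈0 = trans (sum-cong-≋ (λ i → f≈0 (toℕ i) (toℕ<n i))) (sum-replicate-zero n)

  ∑-extend : ∀ (f : ℕ → Carrier) n t → (∀ i → n ≤ i → f i ≈ 0#) →
    ∑[ i < t ℕ.+ n ] f (toℕ i) ≈ ∑[ i < n ] f (toℕ i)
  ∑-extend f n zero f≈0 = refl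
  ∑-extend f n (suc t) f≈0 = begin
    ∑[ i < suc (t ℕ.+ n) ] f (toℕ i)             ≈⟨ ∑-last f (t ℕ.+ n) ⟩
    ∑[ i < t ℕ.+ n ] f (toℕ i) + f (t ℕ.+ n)      ≈⟨ +-cong (∑-extend f n t f≈0) (f≈0 _ (ℕ.m≤n+m n t)) ⟩
    ∑[ i < n ] f (toℕ i) + 0#                     ≈⟨ +-identityʳ _ ⟩
    ∑[ i < n ] f (toℕ i)                          ∎

  ∑-reverse : ∀ (f : ℕ → Carrier) n →
    ∑[ i < suc n ] f (toℕ i) ≈ ∑[ i < suc n ] f (n ∸ toℕ i)
  ∑-reverse f n = trans (∑-permute {suc n} (λ i → f (toℕ i)) reverse)
    (sum-cong-≋ {suc n} (λ i → reflexive (≡.cong f (opposite-prop i))))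

  -1*x+x≈0 : ∀ x → - 1# * x + x ≈ 0#
  -1*x+x≈0 x = trans (+-congˡ (sym (*-identityˡ x)))
    (trans (sym (distribʳ x (- 1#) 1#)) (trans (*-congʳ (-‿inverseˡ 1#)) (zeroˡ x)))

  -1*-1≈1 : - 1# * - 1# ≈ 1#
  -1*-1≈1 = +-cancelʳ (- 1#) _ _ (trans (-1*x+x≈0 (- 1#)) (sym (-‿inverseʳ 1#)))

  sg-double : ∀ t → sg (t ℕ.+ t) ≈ 1#
  sg-double zero = refl
  sg-double (suc t) = begin
    - 1# * sg (t ℕ.+ suc t)       ≡⟨ ≡.cong (λ n → - 1# * sg n) (ℕ.+-suc t t) ⟩
    - 1# * (- 1# * sg (t ℕ.+ t))  ≈⟨ *-assoc _ _ _ ⟨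
    - 1# * - 1# * sg (t ℕ.+ t)    ≈⟨ *-cong -1*-1≈1 (sg-double t) ⟩
    1# * 1#                       ≈⟨ *-identityˡ 1# ⟩
    1#                            ∎

  sg-square : ∀ t → sg t * sg t ≈ 1#
  sg-square t = trans (sym (^-homo-* (- 1#) t t)) (sg-double t)

  -- The coefficients, up to sign, of the polynomial ∑ qⱼ xʲ after x ↦ 1 − x.
  binomialMoment : ℕ → (ℕ → Carrier) → ℕ → Carrier
  binomialMoment M q k = ∑[ j < suc M ] (q (toℕ j) * ⟦ toℕ j C k ⟧)

  moment-last : ∀ M q → binomialMoment M q M ≈ q M
  moment-last M q = begin
    ∑[ j < suc M ] (q (toℕ j) * ⟦ toℕ j C M ⟧)               ≈⟨ ∑-last (λ j → q j * ⟦ j C M ⟧) M ⟩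
    ∑[ j < M ] (q (toℕ j) * ⟦ toℕ j C M ⟧) + q M * ⟦ M C M ⟧ ≈⟨ +-cong (∑-zero (λ j → q j * ⟦ j C M ⟧) M below) (*-congˡ (reflexive (≡.cong ⟦_⟧ (nCn≡1 M)))) ⟩
    0# + q M * (1# + 0#)                                     ≈⟨ solve 1 (λ x → con 0 :+ x :* (con 1 :+ con 0) := x) refl (q M) ⟩
    q M                                                      ∎
    where
    below : ∀ j → j < M → q j * ⟦ j C M ⟧ ≈ 0#
    below j j<M = trans (*-congˡ (reflexive (≡.cong ⟦_⟧ (k>n⇒nCk≡0 j<M)))) (zeroʳ _)

  -- By Pascal's rule. The right side is the moment of index l + 1 of x·q(x): multiplication by x
  -- becomes multiplication by 1 - x after the reflection, which mixes neighbouring moments.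
  moment-pascal : ∀ M q l → binomialMoment M q l + binomialMoment M q (suc l)
    ≈ ∑[ j < suc M ] (q (toℕ j) * ⟦ suc (toℕ j) C suc l ⟧)
  moment-pascal M q l = trans
    (sym (∑-distrib-+ {suc M} (λ j → q (toℕ j) * ⟦ toℕ j C l ⟧) (λ j → q (toℕ j) * ⟦ toℕ j C suc l ⟧)))
    (∑-cong (λ j → q j * ⟦ j C l ⟧ + q j * ⟦ j C suc l ⟧) (λ j → q j * ⟦ suc j C suc l ⟧) (suc M) pascal)
    where
    pascal : ∀ j → j < suc M → q j * ⟦ j C l ⟧ + q j * ⟦ j C suc l ⟧ ≈ q j * ⟦ suc j C suc l ⟧
    pascal j _ = begin
      q j * ⟦ j C l ⟧ + q j * ⟦ j C suc l ⟧  ≈⟨ distribˡ (q j) ⟦ j C l ⟧ ⟦ j C suc l ⟧ ⟨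
      q j * (⟦ j C l ⟧ + ⟦ j C suc l ⟧)      ≈⟨ *-congˡ (⟦⟧-homo-+ (j C l) (j C suc l)) ⟨
      q j * ⟦ j C l ℕ.+ j C suc l ⟧          ≡⟨ ≡.cong (λ c → q j * ⟦ c ⟧) (nCk+nC[k+1]≡[n+1]C[k+1] j l) ⟩
      q j * ⟦ suc j C suc l ⟧                ∎

  -- Abel summation: (l + 2)·C(j+1, l+1) is the increment of (j + 1)·C(j, l+1), and the hypothesis
  -- evaluates the differences of `q` that arise. At the lower end everything vanishes because C(0,
  -- l+1) = 0, which also hides `q′ 0`. The upper boundary term carries the factor M + 2, the future
  -- p.
  ∑-by-parts : ∀ (q q′ : ℕ → Carrier) M l →
    (∀ j → j < M → ⟦ 2 ℕ.+ j ⟧ * q j ≈ ⟦ 2 ℕ.+ j ⟧ * q (suc j) + q′ (suc j)) →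
    ⟦ 2 ℕ.+ l ⟧ * ∑[ j < suc M ] (q (toℕ j) * ⟦ suc (toℕ j) C suc l ⟧)
      ≈ binomialMoment M q′ (suc l) + ⟦ 2 ℕ.+ M ⟧ * (q M * ⟦ suc M C suc l ⟧)
  ∑-by-parts q q′ zero l rec = begin
    K * (q 0 * B 1 + 0#)                        ≈⟨ *-congˡ (+-identityʳ _) ⟩
    K * (q 0 * B 1)                             ≈⟨ solve 3 (λ k x y → k :* (x :* y) := x :* (k :* y)) refl K (q 0) (B 1) ⟩
    q 0 * (K * B 1)                             ≈⟨ *-congˡ absorb ⟩
    q 0 * (⟦ 2 ⟧ * B 1)                         ≈⟨ solve 4 (λ k x y z → x :* (k :* y) := (z :* con 0 :+ con 0) :+ k :* (x :* y)) refl ⟦ 2 ⟧ (q 0) (B 1) (q′ 0) ⟩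
    (q′ 0 * 0# + 0#) + ⟦ 2 ⟧ * (q 0 * B 1)      ∎
    where
    K = ⟦ 2 ℕ.+ l ⟧
    B : ℕ → Carrier
    B j = ⟦ j C suc l ⟧
    absorb : K * B 1 ≈ ⟦ 2 ⟧ * B 1
    absorb = begin
      K * B 1                        ≈⟨ ⟦⟧-homo-* (2 ℕ.+ l) (1 C suc l) ⟨
      ⟦ (2 ℕ.+ l) ℕ.* (1 C suc l) ⟧  ≡⟨ ≡.cong ⟦_⟧ ([1+n]*nCk+[1+k]*[1+n]Ck≡[2+n]*[1+n]Ck 0 (suc l)) ⟩
      ⟦ 2 ℕ.* (1 C suc l) ⟧          ≈⟨ ⟦⟧-homo-* 2 (1 C suc l) ⟩
      ⟦ 2 ⟧ * B 1                    ∎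
  ∑-by-parts q q′ (suc M) l rec = begin
    K * ∑[ j < suc (suc M) ] (q (toℕ j) * B (suc (toℕ j)))
      ≈⟨ *-congˡ (∑-last (λ j → q j * B (suc j)) (suc M)) ⟩
    K * (∑[ j < suc M ] (q (toℕ j) * B (suc (toℕ j))) + q (suc M) * B (2 ℕ.+ M))
      ≈⟨ distribˡ K _ _ ⟩
    K * ∑[ j < suc M ] (q (toℕ j) * B (suc (toℕ j))) + K * (q (suc M) * B (2 ℕ.+ M))
      ≈⟨ +-congʳ (∑-by-parts q q′ M l (λ j j<M → rec j (ℕ.m<n⇒m<1+n j<M))) ⟩
    S + N * (q M * B (suc M)) + K * (q (suc M) * B (2 ℕ.+ M))
      ≈⟨ solve 7 (λ s n q b k r c → s :+ n :* (q :* b) :+ k :* (r :* c) := s :+ (n :* q) :* b :+ r :* (k :* c))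
           refl S N (q M) (B (suc M)) K (q (suc M)) (B (2 ℕ.+ M)) ⟩
    S + (N * q M) * B (suc M) + q (suc M) * (K * B (2 ℕ.+ M))
      ≈⟨ +-congʳ (+-congˡ (*-congʳ (rec M ℕ.≤-refl))) ⟩
    S + (N * q (suc M) + q′ (suc M)) * B (suc M) + q (suc M) * (K * B (2 ℕ.+ M))
      ≈⟨ solve 6 (λ s n r d b x → s :+ (n :* r :+ d) :* b :+ r :* x := (s :+ d :* b) :+ r :* (n :* b :+ x))
           refl S N (q (suc M)) (q′ (suc M)) (B (suc M)) (K * B (2 ℕ.+ M)) ⟩
    (S + q′ (suc M) * B (suc M)) + q (suc M) * (N * B (suc M) + K * B (2 ℕ.+ M))
      ≈⟨ +-cong (sym (∑-last (λ j → q′ j * B j) (suc M))) (*-congˡ absorb) ⟩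
    binomialMoment (suc M) q′ (suc l) + q (suc M) * (⟦ 3 ℕ.+ M ⟧ * B (2 ℕ.+ M))
      ≈⟨ +-congˡ (solve 3 (λ k x y → x :* (k :* y) := k :* (x :* y)) refl ⟦ 3 ℕ.+ M ⟧ (q (suc M)) (B (2 ℕ.+ M))) ⟩
    binomialMoment (suc M) q′ (suc l) + ⟦ 3 ℕ.+ M ⟧ * (q (suc M) * B (2 ℕ.+ M)) ∎
    where
    K = ⟦ 2 ℕ.+ l ⟧
    N = ⟦ 2 ℕ.+ M ⟧
    S = binomialMoment M q′ (suc l)
    B : ℕ → Carrier
    B j = ⟦ j C suc l ⟧
    absorb : N * B (suc M) + K * B (2 ℕ.+ M) ≈ ⟦ 3 ℕ.+ M ⟧ * B (2 ℕ.+ M)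
    absorb = begin
      N * B (suc M) + K * B (2 ℕ.+ M)
        ≈⟨ +-cong (⟦⟧-homo-* (2 ℕ.+ M) (suc M C suc l)) (⟦⟧-homo-* (2 ℕ.+ l) ((2 ℕ.+ M) C suc l)) ⟨
      ⟦ (2 ℕ.+ M) ℕ.* (suc M C suc l) ⟧ + ⟦ (2 ℕ.+ l) ℕ.* ((2 ℕ.+ M) C suc l) ⟧
        ≈⟨ ⟦⟧-homo-+ ((2 ℕ.+ M) ℕ.* (suc M C suc l)) ((2 ℕ.+ l) ℕ.* ((2 ℕ.+ M) C suc l)) ⟨
      ⟦ (2 ℕ.+ M) ℕ.* (suc M C suc l) ℕ.+ (2 ℕ.+ l) ℕ.* ((2 ℕ.+ M) C suc l) ⟧
        ≡⟨ ≡.cong ⟦_⟧ ([1+n]*nCk+[1+k]*[1+n]Ck≡[2+n]*[1+n]Ck (suc M) (suc l)) ⟩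
      ⟦ (3 ℕ.+ M) ℕ.* ((2 ℕ.+ M) C suc l) ⟧
        ≈⟨ ⟦⟧-homo-* (3 ℕ.+ M) ((2 ℕ.+ M) C suc l) ⟩
      ⟦ 3 ℕ.+ M ⟧ * B (2 ℕ.+ M) ∎

  downward : ∀ {M} {P : ℕ → Set ℓ} → P M → (∀ k → k < M → P (suc k) → P k) → ∀ k → k ≤ M → P k
  downward {zero} last step zero z≤n = last
  downward {suc M} {P} last step zero z≤n =
    step 0 (s≤s z≤n) (downward {M} {λ k → P (suc k)} last (λ k k<M → step (suc k) (s≤s k<M)) 0 z≤n)
  downward {suc M} {P} last step (suc k) (s≤s k≤M) =
    downward {M} {λ k → P (suc k)} last (λ k k<M → step (suc k) (s≤s k<M)) k k≤M

  -- Reflection symmetry when M + 2 vanishes and 2, ..., M + 1 can be cancelled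

  module _ (M : ℕ) (char : ⟦ 2 ℕ.+ M ⟧ ≈ 0#)
    (cancel : ∀ k x y → k < M → ⟦ 2 ℕ.+ k ⟧ * x ≈ ⟦ 2 ℕ.+ k ⟧ * y → x ≈ y)
    where

    -- d n j is the coefficient of xʲ in Qₙ, and d-rec expresses (x(x − 1)Qₙ₊₁)′ = Qₙ.
    module _ (d : ℕ → ℕ → Carrier)
      (d-zero : ∀ k → d 0 k ≈ 0#)
      (d-last : ∀ n → d n M ≈ sg M * sg n * d n M)
      (d-rec : ∀ n k → k < M →
        ⟦ 2 ℕ.+ k ⟧ * d (suc n) k ≈ ⟦ 2 ℕ.+ k ⟧ * d (suc n) (suc k) + d n (suc k))
      where

      -- Up to alternating signs this is `d-rec` for the reflected polynomial; `char` removes the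
      -- boundary term of the summation by parts.
      moment-rec : ∀ n l →
        ⟦ 2 ℕ.+ l ⟧ * binomialMoment M (d (suc n)) l + ⟦ 2 ℕ.+ l ⟧ * binomialMoment M (d (suc n)) (suc l)
          ≈ binomialMoment M (d n) (suc l)
      moment-rec n l = begin
        K * binomialMoment M (d (suc n)) l + K * binomialMoment M (d (suc n)) (suc l)
          ≈⟨ distribˡ K _ _ ⟨
        K * (binomialMoment M (d (suc n)) l + binomialMoment M (d (suc n)) (suc l))
          ≈⟨ *-congˡ (moment-pascal M (d (suc n)) l) ⟩
        K * ∑[ j < suc M ] (d (suc n) (toℕ j) * ⟦ suc (toℕ j) C suc l ⟧)
          ≈⟨ ∑-by-parts (d (suc n)) (d n) M l (d-rec n) ⟩
        binomialMoment M (d n) (suc l) + ⟦ 2 ℕ.+ M ⟧ * (d (suc n) M * ⟦ suc M C suc l ⟧)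
          ≈⟨ +-congˡ (trans (*-congʳ char) (zeroˡ _)) ⟩
        binomialMoment M (d n) (suc l) + 0#
          ≈⟨ +-identityʳ _ ⟩
        binomialMoment M (d n) (suc l) ∎
        where K = ⟦ 2 ℕ.+ l ⟧

      -- Two nested inductions. The outer one on n supplies the right side of `moment-rec`; the
      -- inner one descends from k = M, because after cancelling k + 2 the recursion yields entry k
      -- from entry k + 1.
      moment≈ : ∀ n k → k ≤ M → binomialMoment M (d n) k ≈ sg k * sg n * d n k
      moment≈ zero k k≤M = trans
        (∑-zero (λ j → d 0 j * ⟦ j C k ⟧) (suc M) (λ j _ → trans (*-congʳ (d-zero j)) (zeroˡ _)))
        (sym (trans (*-congˡ (d-zero k)) (zeroʳ _)))
      moment≈ (suc n) = downward (trans (moment-last M (d (suc n))) (d-last (suc n))) step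
        where
        step : ∀ k → k < M → binomialMoment M (d (suc n)) (suc k) ≈ sg (suc k) * sg (suc n) * d (suc n) (suc k) →
          binomialMoment M (d (suc n)) k ≈ sg k * sg (suc n) * d (suc n) k
        step k k<M ih = cancel k _ _ k<M (+-cancelʳ (K * binomialMoment M (d (suc n)) (suc k)) _ _ (begin
          K * binomialMoment M (d (suc n)) k + K * binomialMoment M (d (suc n)) (suc k)
            ≈⟨ moment-rec n k ⟩
          binomialMoment M (d n) (suc k)
            ≈⟨ moment≈ n (suc k) k<M ⟩
          - 1# * a * b * d′
            ≈⟨ +-identityˡ _ ⟨
          0# + - 1# * a * b * d′
            -- The semiring solver treats -1 as an indeterminate, so the cancelling pair that
            -- completes `K * D + d′` is inserted by hand.
            ≈⟨ +-congʳ (-1*x+x≈0 _) ⟨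
          - 1# * (a * (- 1# * b) * (K * D)) + a * (- 1# * b) * (K * D) + - 1# * a * b * d′
            ≈⟨ solve 6 (λ e a b k D d → e :* (a :* (e :* b) :* (k :* D)) :+ a :* (e :* b) :* (k :* D) :+ e :* a :* b :* d
                 := a :* (e :* b) :* (k :* D :+ d) :+ k :* ((e :* a) :* (e :* b) :* D)) refl (- 1#) a b K D d′ ⟩
          a * (- 1# * b) * (K * D + d′) + K * ((- 1# * a) * (- 1# * b) * D)
            ≈⟨ +-cong (*-congˡ (sym (d-rec n k k<M))) (*-congˡ (sym ih)) ⟩
          a * (- 1# * b) * (K * d (suc n) k) + K * binomialMoment M (d (suc n)) (suc k)
            ≈⟨ +-congʳ (solve 3 (λ a k d → a :* (k :* d) := k :* (a :* d)) refl (a * (- 1# * b)) K (d (suc n) k)) ⟩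
          K * (a * (- 1# * b) * d (suc n) k) + K * binomialMoment M (d (suc n)) (suc k) ∎))
          where
          K = ⟦ 2 ℕ.+ k ⟧
          a = sg k
          b = sg n
          D = d (suc n) (suc k)
          d′ = d n (suc k)

      -- Replacing each `a j` by its binomial transform and exchanging the sums moves the transform
      -- onto the coefficients, where `moment≈` applies. The factor `sg k` then occurs twice and
      -- disappears.
      ∑-self-dual : ∀ n (a : ℕ → Carrier) →
        (∀ r → r ≤ M → ∑[ k < suc r ] (⟦ r C toℕ k ⟧ * sg (toℕ k) * a (toℕ k)) ≈ a r) →
        ∑[ j < suc M ] (d n (toℕ j) * a (toℕ j)) ≈ sg n * ∑[ j < suc M ] (d n (toℕ j) * a (toℕ j))
      ∑-self-dual n a invariant = begin
        ∑[ j < suc M ] (d n (toℕ j) * a (toℕ j))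
          ≈⟨ ∑-cong (λ j → d n j * a j) (λ j → ∑[ k < suc M ] t j (toℕ k)) (suc M) (λ j j<1+M →
               trans (*-congˡ (sym (full j (ℕ.≤-pred j<1+M))))
                 (*-distribˡ-sum {suc M} (d n j) (λ k → f j (toℕ k)))) ⟩
        ∑[ j < suc M ] ∑[ k < suc M ] t (toℕ j) (toℕ k)
          ≈⟨ ∑-comm {suc M} {suc M} (λ j k → t (toℕ j) (toℕ k)) ⟩
        ∑[ k < suc M ] ∑[ j < suc M ] t (toℕ j) (toℕ k)
          ≈⟨ ∑-cong (λ k → ∑[ j < suc M ] t (toℕ j) k) (λ k → sg n * (d n k * a k)) (suc M) (λ k k<1+M →
               column k (ℕ.≤-pred k<1+M)) ⟩
        ∑[ k < suc M ] (sg n * (d n (toℕ k) * a (toℕ k)))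
          ≈⟨ *-distribˡ-sum {suc M} (sg n) (λ k → d n (toℕ k) * a (toℕ k)) ⟨
        sg n * ∑[ k < suc M ] (d n (toℕ k) * a (toℕ k)) ∎
        where
        f t : ℕ → ℕ → Carrier
        f r k = ⟦ r C k ⟧ * sg k * a k
        t j k = d n j * f j k
        -- Binomial coefficients beyond r vanish, so every inner sum may run up to M; the double sum
        -- becomes rectangular and can be exchanged.
        full : ∀ r → r ≤ M → ∑[ k < suc M ] f r (toℕ k) ≈ a r
        full r r≤M = begin
          ∑[ k < suc M ] f r (toℕ k)
            ≡⟨ ≡.cong (λ n → ∑[ k < n ] f r (toℕ k)) (≡.sym (≡.trans (ℕ.+-suc (M ∸ r) r) (≡.cong suc (ℕ.m∸n+n≡m r≤M)))) ⟩
          ∑[ k < (M ∸ r) ℕ.+ suc r ] f r (toℕ k)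
            ≈⟨ ∑-extend (f r) (suc r) (M ∸ r) (λ k r<k → trans (*-congʳ (trans (*-congʳ
                 (reflexive (≡.cong ⟦_⟧ (k>n⇒nCk≡0 r<k)))) (zeroˡ (sg k)))) (zeroˡ (a k))) ⟩
          ∑[ k < suc r ] f r (toℕ k)
            ≈⟨ invariant r r≤M ⟩
          a r ∎
        column : ∀ k → k ≤ M → ∑[ j < suc M ] t (toℕ j) k ≈ sg n * (d n k * a k)
        column k k≤M = begin
          ∑[ j < suc M ] t (toℕ j) k
            ≈⟨ ∑-cong (λ j → t j k) (λ j → d n j * ⟦ j C k ⟧ * (sg k * a k)) (suc M) (λ j _ →
                 solve 4 (λ x y z w → x :* (y :* z :* w) := (x :* y) :* (z :* w)) refl (d n j) ⟦ j C k ⟧ (sg k) (a k)) ⟩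
          ∑[ j < suc M ] (d n (toℕ j) * ⟦ toℕ j C k ⟧ * (sg k * a k))
            ≈⟨ *-distribʳ-sum {suc M} (sg k * a k) (λ j → d n (toℕ j) * ⟦ toℕ j C k ⟧) ⟨
          binomialMoment M (d n) k * (sg k * a k)
            ≈⟨ *-congʳ (moment≈ n k k≤M) ⟩
          sg k * sg n * d n k * (sg k * a k)
            ≈⟨ solve 4 (λ s n d a → s :* n :* d :* (s :* a) := (s :* s) :* (n :* (d :* a))) refl (sg k) (sg n) (d n k) (a k) ⟩
          sg k * sg k * (sg n * (d n k * a k))
            ≈⟨ *-congʳ (sg-square k) ⟩
          1# * (sg n * (d n k * a k))
            ≈⟨ *-identityˡ _ ⟩
          sg n * (d n k * a k) ∎

    module _ (e : ℕ → ℕ → Carrier)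
      (e-zero : ∀ k → e 0 k ≈ 1#)
      (e-last : ∀ n → e (suc n) M ≈ 0#)
      (e-rec : ∀ n k → k < M →
        ⟦ 2 ℕ.+ k ⟧ * e (suc n) k ≈ ⟦ 2 ℕ.+ k ⟧ * e (suc n) (suc k) + e n (suc k))
      where

      -- At the odd index 2t + 1 self-duality reads U = -U, and 0 < M allows 2 to be cancelled.
      -- Since `e` starts at Q₁, the sequence `d` prepends Q₀ = 0. The parity of M enters at the top
      -- coefficient of Q₁.
      ∑-invariant≈0 : sg (suc M) ≈ 1# → 0 < M → ∀ t (a : ℕ → Carrier) →
        (∀ r → r ≤ M → ∑[ k < suc r ] (⟦ r C toℕ k ⟧ * sg (toℕ k) * a (toℕ k)) ≈ a r) →
        ∑[ j < suc M ] (e (t ℕ.+ t) (toℕ j) * a (toℕ j)) ≈ 0#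
      ∑-invariant≈0 odd 0<M t a invariant = cancel 0 U 0# 0<M (begin
        ⟦ 2 ⟧ * U                ≈⟨ solve 1 (λ u → (con 1 :+ (con 1 :+ con 0)) :* u := u :+ u) refl U ⟩
        U + U                    ≈⟨ +-congʳ (∑-self-dual d (λ _ → refl) d-last d-rec (suc (t ℕ.+ t)) a invariant) ⟩
        - 1# * sg (t ℕ.+ t) * U + U  ≈⟨ +-congʳ (*-congʳ (trans (*-congˡ (sg-double t)) (*-identityʳ _))) ⟩
        - 1# * U + U             ≈⟨ -1*x+x≈0 U ⟩
        0#                       ≈⟨ zeroʳ ⟦ 2 ⟧ ⟨
        ⟦ 2 ⟧ * 0#               ∎)
        where
        U = ∑[ j < suc M ] (e (t ℕ.+ t) (toℕ j) * a (toℕ j))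
        d : ℕ → ℕ → Carrier
        d zero    k = 0#
        d (suc n) k = e n k
        d-last : ∀ n → d n M ≈ sg M * sg n * d n M
        d-last zero = sym (zeroʳ _)
        d-last (suc zero) = sym (begin
          sg M * (- 1# * 1#) * e 0 M  ≈⟨ solve 3 (λ s m x → s :* (m :* con 1) :* x := m :* s :* x) refl (sg M) (- 1#) (e 0 M) ⟩
          - 1# * sg M * e 0 M         ≈⟨ *-congʳ odd ⟩
          1# * e 0 M                  ≈⟨ *-identityˡ _ ⟩
          e 0 M                       ∎)
        d-last (suc (suc n)) = trans (e-last n) (sym (trans (*-congˡ (e-last n)) (zeroʳ _)))
        d-rec : ∀ n k → k < M → ⟦ 2 ℕ.+ k ⟧ * d (suc n) k ≈ ⟦ 2 ℕ.+ k ⟧ * d (suc n) (suc k) + d n (suc k)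
        d-rec zero k k<M = trans (*-congˡ (trans (e-zero k) (sym (e-zero (suc k))))) (sym (+-identityʳ _))
        d-rec (suc n) k k<M = e-rec n k k<M

      -- In the recursion of `g` the lower-order term has the opposite sign, so `sg n * e n` solves
      -- it with the same top values. Uniqueness of the solution does the work of a substitution
      -- reversing all indices of an iterated sum.
      reflected : ∀ (g : ℕ → ℕ → Carrier) →
        (∀ k → g 0 k ≈ 1#) → (∀ n → g (suc n) M ≈ 0#) →
        (∀ n k → k < M → ⟦ 2 ℕ.+ k ⟧ * g (suc n) k + g n (suc k) ≈ ⟦ 2 ℕ.+ k ⟧ * g (suc n) (suc k)) →
        ∀ n k → k ≤ M → g n k ≈ sg n * e n k
      reflected g g-zero g-last g-rec zero k k≤M =
        trans (g-zero k) (sym (trans (*-identityˡ _) (e-zero k)))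
      reflected g g-zero g-last g-rec (suc n) = downward
        (trans (g-last n) (sym (trans (*-congˡ (e-last n)) (zeroʳ _)))) step
        where
        step : ∀ k → k < M → g (suc n) (suc k) ≈ sg (suc n) * e (suc n) (suc k) →
          g (suc n) k ≈ sg (suc n) * e (suc n) k
        step k k<M ih = cancel k _ _ k<M (+-cancelʳ (g n (suc k)) _ _ (begin
          K * g (suc n) k + g n (suc k)
            ≈⟨ g-rec n k k<M ⟩
          K * g (suc n) (suc k)
            ≈⟨ *-congˡ ih ⟩
          K * (- 1# * s * e (suc n) (suc k))
            ≈⟨ +-identityʳ _ ⟨
          K * (- 1# * s * e (suc n) (suc k)) + 0#
            ≈⟨ +-congˡ (-1*x+x≈0 (s * e n (suc k))) ⟨
          K * (- 1# * s * e (suc n) (suc k)) + (- 1# * (s * e n (suc k)) + s * e n (suc k))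
            ≈⟨ solve 5 (λ k m s x y → k :* (m :* s :* x) :+ (m :* (s :* y) :+ s :* y) := m :* s :* (k :* x :+ y) :+ s :* y)
                 refl K (- 1#) s (e (suc n) (suc k)) (e n (suc k)) ⟩
          - 1# * s * (K * e (suc n) (suc k) + e n (suc k)) + s * e n (suc k)
            ≈⟨ +-cong (*-congˡ (sym (e-rec n k k<M))) (sym (reflected g g-zero g-last g-rec n (suc k) k<M)) ⟩
          - 1# * s * (K * e (suc n) k) + g n (suc k)
            ≈⟨ +-congʳ (solve 3 (λ a k x → a :* (k :* x) := k :* (a :* x)) refl (- 1# * s) K (e (suc n) k)) ⟩
          K * (- 1# * s * e (suc n) k) + g n (suc k) ∎))
          where
          K = ⟦ 2 ℕ.+ k ⟧
          s = sg n

-- Reciprocals of natural numbers in ℚ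

open import Data.Product.Base using (_×_; _,_; proj₁; proj₂; ∃)
open import Data.Rational.Base using (ℚ; 0ℚ; 1ℚ; ½; _+_; _*_; _-_; -_; _/_; ↧_; ↧ₙ_; toℚᵘ)
open import Data.Rational.Properties
open import Data.Rational.Solver using (module +-*-Solver)
open ≡ using (refl; sym; trans; cong; cong₂; subst; module ≡-Reasoning)

module ℚ∑ = CommutativeRingSums +-*-commutativeRing
open ℚ∑ using (⟦_⟧; sg; sum-syntax; ∑-cong)
open +-*-Solver using (solve; con; _:=_; _:+_; _:*_; :-_; _:-_)

n/1≡⟦n⟧ : ∀ n → ℤ.+ n / 1 ≡ ⟦ n ⟧
n/1≡⟦n⟧ zero = refl
n/1≡⟦n⟧ (suc n) = begin
  ℤ.+ suc n / 1         ≡⟨ toℚᵘ-injective unnormalised ⟩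
  1ℚ + (ℤ.+ n / 1)      ≡⟨ cong (1ℚ +_) (n/1≡⟦n⟧ n) ⟩
  1ℚ + ⟦ n ⟧          ∎
  where
  open ≡-Reasoning
  unnormalised : toℚᵘ (ℤ.+ suc n / 1) ℚᵘ.≃ toℚᵘ (1ℚ + (ℤ.+ n / 1))
  unnormalised = ℚᵘ.≃-trans (toℚᵘ-fromℚᵘ (ℚᵘ.mkℚᵘ (ℤ.+ suc n) 0))
    (ℚᵘ.≃-trans (ℚᵘ.*≡* (cong (ℤ._* ℤ.+ 1) (cong (ℤ._+_ (ℤ.+ 1)) (sym (ℤ.*-identityʳ (ℤ.+ n))))))
    (ℚᵘ.≃-sym (ℚᵘ.≃-trans (toℚᵘ-homo-+ 1ℚ (ℤ.+ n / 1)) (ℚᵘ.+-congʳ (toℚᵘ 1ℚ) (toℚᵘ-fromℚᵘ (ℚᵘ.mkℚᵘ (ℤ.+ n) 0))))))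

opaque
  recip : ℕ → ℚ
  recip d = 1ℚ /ₙ d

  /ₙ≡*recip : ∀ x d → x /ₙ d ≡ x * recip d
  /ₙ≡*recip x zero    = sym (*-zeroʳ x)
  /ₙ≡*recip x (suc d) = cong (x *_) (sym (*-identityˡ (ℤ.+ 1 / suc d)))

  recip-inverse : ∀ d → recip (suc d) * ⟦ suc d ⟧ ≡ 1ℚ
  recip-inverse d = begin
    1ℚ * (ℤ.+ 1 / suc d) * ⟦ suc d ⟧     ≡⟨ cong₂ _*_ (*-identityˡ (ℤ.+ 1 / suc d)) (sym (n/1≡⟦n⟧ (suc d))) ⟩
    (ℤ.+ 1 / suc d) * (ℤ.+ suc d / 1)      ≡⟨ toℚᵘ-injective unnormalised ⟩
    1ℚ                                 ∎
    where
    open ≡-Reasoning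
    unnormalised : toℚᵘ ((ℤ.+ 1 / suc d) * (ℤ.+ suc d / 1)) ℚᵘ.≃ toℚᵘ 1ℚ
    unnormalised = ℚᵘ.≃-trans (toℚᵘ-homo-* (ℤ.+ 1 / suc d) (ℤ.+ suc d / 1))
      (ℚᵘ.≃-trans (ℚᵘ.*-cong (toℚᵘ-fromℚᵘ (ℚᵘ.mkℚᵘ (ℤ.+ 1) d)) (toℚᵘ-fromℚᵘ (ℚᵘ.mkℚᵘ (ℤ.+ suc d) 0)))
      (ℚᵘ.*≡* (cong ℤ.+_ (trans (ℕ.*-identityʳ (suc d ℕ.+ 0)) (trans (ℕ.+-identityʳ (suc d))
        (sym (trans (ℕ.+-identityʳ (suc d ℕ.* 1)) (ℕ.*-identityʳ (suc d)))))))))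

  recip-1 : recip 1 ≡ 1ℚ
  recip-1 = refl

  recip-0 : recip 0 ≡ 0ℚ
  recip-0 = refl

-- The convention that dividing by 0 gives 0 makes this true on all of ℕ, so reciprocals of products
-- over index vectors split unconditionally.
recip-homo-* : ∀ m n → recip (m ℕ.* n) ≡ recip m * recip n
recip-homo-* zero n = trans recip-0 (sym (trans (cong (_* recip n) recip-0) (*-zeroˡ (recip n))))
recip-homo-* (suc m) zero = trans (trans (cong recip (ℕ.*-zeroʳ m)) recip-0)
  (sym (trans (cong (recip (suc m) *_) recip-0) (*-zeroʳ (recip (suc m)))))
recip-homo-* (suc m) (suc n) = begin
  r                                           ≡⟨ *-identityʳ r ⟨
  r * 1ℚ                                      ≡⟨ cong (r *_) (cong₂ _*_ (recip-inverse m) (recip-inverse n)) ⟨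
  r * (x * ⟦ suc m ⟧ * (y * ⟦ suc n ⟧))       ≡⟨ solve 5 (λ r x a y b → r :* (x :* a :* (y :* b)) := r :* (a :* b) :* (x :* y)) refl r x ⟦ suc m ⟧ y ⟦ suc n ⟧ ⟩
  r * (⟦ suc m ⟧ * ⟦ suc n ⟧) * (x * y)       ≡⟨ cong (λ z → r * z * (x * y)) (ℚ∑.⟦⟧-homo-* (suc m) (suc n)) ⟨
  r * ⟦ suc m ℕ.* suc n ⟧ * (x * y)           ≡⟨ cong (_* (x * y)) (recip-inverse (n ℕ.+ m ℕ.* suc n)) ⟩
  1ℚ * (x * y)                                ≡⟨ *-identityˡ (x * y) ⟩
  x * y                                       ∎
  where
  open ≡-Reasoning
  r = recip (suc m ℕ.* suc n)
  x = recip (suc m)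
  y = recip (suc n)

-- Iterated sums over increasing indices

m<n∸o⇒o+m<n : ∀ m n o → m < n ∸ o → o ℕ.+ m < n
m<n∸o⇒o+m<n m n o m<n∸o = subst (o ℕ.+ m <_)
  (ℕ.m+[n∸m]≡n {o} {n} (ℕ.<⇒≤ (ℕ.m∸n≢0⇒n<m (ℕ.m<n⇒n≢0 m<n∸o)))) (ℕ.+-monoʳ-< o m<n∸o)

sumBetween-cong : ∀ {f g} lo hi → (∀ k → lo < k → k < hi → f k ≡ g k) → sumBetween lo hi f ≡ sumBetween lo hi g
sumBetween-cong {f} {g} lo hi f≡g = ∑-cong (λ i → f (suc lo ℕ.+ i)) (λ i → g (suc lo ℕ.+ i)) (hi ∸ suc lo)
  (λ i i<hi∸1+lo → f≡g (suc lo ℕ.+ i) (s≤s (ℕ.m≤m+n lo i))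
    (m<n∸o⇒o+m<n i hi (suc lo) i<hi∸1+lo))

sumBetween-empty : ∀ lo hi f → hi ≤ suc lo → sumBetween lo hi f ≡ 0ℚ
sumBetween-empty lo hi f hi≤1+lo = cong (λ n → ∑[ i < n ] f (suc lo ℕ.+ toℕ i)) (ℕ.m≤n⇒m∸n≡0 hi≤1+lo)

sumBetween-last : ∀ lo hi f → lo < hi → sumBetween lo (suc hi) f ≡ sumBetween lo hi f + f hi
sumBetween-last lo hi f lo<hi = begin
  ∑[ i < suc hi ∸ suc lo ] f (suc lo ℕ.+ toℕ i)    ≡⟨ cong (λ n → ∑[ i < n ] f (suc lo ℕ.+ toℕ i)) (ℕ.+-∸-assoc 1 lo<hi) ⟩
  ∑[ i < suc (hi ∸ suc lo) ] f (suc lo ℕ.+ toℕ i)  ≡⟨ ℚ∑.∑-last (λ i → f (suc lo ℕ.+ i)) (hi ∸ suc lo) ⟩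
  sumBetween lo hi f + f (suc lo ℕ.+ (hi ∸ suc lo)) ≡⟨ cong (λ k → sumBetween lo hi f + f k) (ℕ.m+[n∸m]≡n lo<hi) ⟩
  sumBetween lo hi f + f hi                         ∎
  where open ≡-Reasoning

sumBetween-head : ∀ lo hi f → suc lo < hi → sumBetween lo hi f ≡ f (suc lo) + sumBetween (suc lo) hi f
sumBetween-head lo hi f 1+lo<hi = begin
  ∑[ i < hi ∸ suc lo ] f (suc lo ℕ.+ toℕ i)
    ≡⟨ cong (λ n → ∑[ i < n ] f (suc lo ℕ.+ toℕ i)) (sym (ℕ.+-∸-assoc 1 1+lo<hi)) ⟨
  f (suc lo ℕ.+ 0) + ∑[ i < hi ∸ suc (suc lo) ] f (suc lo ℕ.+ suc (toℕ i))
    ≡⟨ cong₂ _+_ (cong f (ℕ.+-identityʳ (suc lo)))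
         (∑-cong (λ i → f (suc lo ℕ.+ suc i)) (λ i → f (suc (suc lo) ℕ.+ i)) (hi ∸ suc (suc lo)) (λ i _ → cong f (ℕ.+-suc (suc lo) i))) ⟩
  f (suc lo) + sumBetween (suc lo) hi f ∎
  where open ≡-Reasoning

sumBetween-+ : ∀ lo hi f g → sumBetween lo hi (λ k → f k + g k) ≡ sumBetween lo hi f + sumBetween lo hi g
sumBetween-+ lo hi f g = ℚ∑.∑-distrib-+ {hi ∸ suc lo} (λ i → f (suc lo ℕ.+ toℕ i)) (λ i → g (suc lo ℕ.+ toℕ i))

sumIncreasing-cong : ∀ n lo hi {F G} → (∀ ks → F ks ≡ G ks) → sumIncreasing n lo hi F ≡ sumIncreasing n lo hi G
sumIncreasing-cong zero    lo hi F≡G = F≡G []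
sumIncreasing-cong (suc n) lo hi {F} F≡G = sumBetween-cong lo hi (λ k _ _ → sumIncreasing-cong n k hi (λ ks → F≡G (k ∷ ks)))

sumIncreasing-* : ∀ n lo hi c F → sumIncreasing n lo hi (λ ks → c * F ks) ≡ c * sumIncreasing n lo hi F
sumIncreasing-* zero    lo hi c F = refl
sumIncreasing-* (suc n) lo hi c F = trans
  (sumBetween-cong {g = λ k → c * sumIncreasing n k hi (λ ks → F (k ∷ ks))} lo hi (λ k _ _ → sumIncreasing-* n k hi c (λ ks → F (k ∷ ks))))
  (sym (ℚ∑.*-distribˡ-sum {hi ∸ suc lo} c (λ i → sumIncreasing n (suc lo ℕ.+ toℕ i) hi (λ ks → F ((suc lo ℕ.+ toℕ i) ∷ ks)))))

sumIncreasing-empty : ∀ n lo hi F → hi ≤ suc lo → sumIncreasing (suc n) lo hi F ≡ 0ℚ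
sumIncreasing-empty n lo hi F = sumBetween-empty lo hi (λ k → sumIncreasing n k hi (λ ks → F (k ∷ ks)))

-- Splits on whether the largest index equals `hi`. In the induction the outer index k = `hi` leaves
-- an empty inner range and contributes 0.
sumIncreasing-last : ∀ n lo hi F → lo < hi →
  sumIncreasing (suc n) lo (suc hi) F ≡ sumIncreasing (suc n) lo hi F + sumIncreasing n lo hi (λ ks → F (ks ∷ʳ hi))
sumIncreasing-last zero lo hi F lo<hi = sumBetween-last lo hi (λ k → F (k ∷ [])) lo<hi
sumIncreasing-last (suc n) lo hi F lo<hi = begin
  sumBetween lo (suc hi) (λ k → S k (suc hi))
    ≡⟨ sumBetween-last lo hi (λ k → S k (suc hi)) lo<hi ⟩
  sumBetween lo hi (λ k → S k (suc hi)) + S hi (suc hi)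
    ≡⟨ cong₂ _+_ (sumBetween-cong lo hi (λ k _ k<hi → sumIncreasing-last n k hi (λ ks → F (k ∷ ks)) k<hi))
         (sumIncreasing-empty n hi (suc hi) (λ ks → F (hi ∷ ks)) ℕ.≤-refl) ⟩
  sumBetween lo hi (λ k → S k hi + sumIncreasing n k hi (λ ks → F (k ∷ (ks ∷ʳ hi)))) + 0ℚ
    ≡⟨ +-identityʳ _ ⟩
  sumBetween lo hi (λ k → S k hi + sumIncreasing n k hi (λ ks → F (k ∷ (ks ∷ʳ hi))))
    ≡⟨ sumBetween-+ lo hi (λ k → S k hi) (λ k → sumIncreasing n k hi (λ ks → F (k ∷ (ks ∷ʳ hi)))) ⟩
  sumIncreasing (suc (suc n)) lo hi F + sumIncreasing (suc n) lo hi (λ ks → F (ks ∷ʳ hi)) ∎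
  where
  open ≡-Reasoning
  S : ℕ → ℕ → ℚ
  S k h = sumIncreasing (suc n) k h (λ ks → F (k ∷ ks))

∏-∷ʳ : ∀ {n} (ks : Vec ℕ n) k → ∏ (ks ∷ʳ k) ≡ ∏ ks ℕ.* k
∏-∷ʳ []       k = trans (ℕ.*-identityʳ k) (sym (ℕ.+-identityʳ k))
∏-∷ʳ (j ∷ ks) k = trans (cong (j ℕ.*_) (∏-∷ʳ ks k)) (sym (ℕ.*-assoc j (∏ ks) k))

∏-init-last : ∀ {n} (ks : Vec ℕ (suc n)) → ∏ ks ≡ ∏ (init ks) ℕ.* last ks
∏-init-last ks with ys , y , refl ← initLast ks = ∏-∷ʳ ys y

-- The elementary symmetric polynomial of degree n in the reciprocals 1/k with lo < k < hi.
harmonic : ℕ → ℕ → ℕ → ℚ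
harmonic n lo hi = sumIncreasing n lo hi (λ ks → recip (∏ ks))

sumIncreasing-by-head : ∀ n lo hi (g : ℕ → ℚ) →
  sumIncreasing (suc n) lo hi (λ ks → g (head ks) * recip (∏ (tail ks)))
    ≡ sumBetween lo hi (λ k → g k * harmonic n k hi)
sumIncreasing-by-head n lo hi g =
  sumBetween-cong lo hi (λ k _ _ → sumIncreasing-* n k hi (g k) (λ ks → recip (∏ ks)))

-- The iterated sum chooses the smallest index at the outermost level, so isolating the largest one
-- takes an induction on the upper bound. The bounds 0 and 1 give empty ranges.
sumIncreasing-by-last : ∀ n hi (g : ℕ → ℚ) →
  sumIncreasing (suc n) 0 hi (λ ks → g (last ks) * recip (∏ (init ks)))
    ≡ sumBetween 0 hi (λ k → g k * harmonic n 0 k)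
sumIncreasing-by-last n zero g = refl
sumIncreasing-by-last n (suc zero) g = refl
sumIncreasing-by-last n (suc hi@(suc _)) g = begin
  sumIncreasing (suc n) 0 (suc hi) F
    ≡⟨ sumIncreasing-last n 0 hi F (s≤s z≤n) ⟩
  sumIncreasing (suc n) 0 hi F + sumIncreasing n 0 hi (λ ks → F (ks ∷ʳ hi))
    ≡⟨ cong₂ _+_ (sumIncreasing-by-last n hi g)
         (trans (sumIncreasing-cong n 0 hi (λ ks → cong₂ (λ x xs → g x * recip (∏ xs)) (last-∷ʳ hi ks) (init-∷ʳ hi ks)))
           (sumIncreasing-* n 0 hi (g hi) (λ ks → recip (∏ ks)))) ⟩
  sumBetween 0 hi (λ k → g k * harmonic n 0 k) + g hi * harmonic n 0 hi
    ≡⟨ sumBetween-last 0 hi (λ k → g k * harmonic n 0 k) (s≤s z≤n) ⟨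
  sumBetween 0 (suc hi) (λ k → g k * harmonic n 0 k) ∎
  where
  open ≡-Reasoning
  F : Vec ℕ (suc n) → ℚ
  F ks = g (last ks) * recip (∏ (init ks))

harmonic-by-head : ∀ n lo hi → harmonic (suc n) lo hi ≡ sumBetween lo hi (λ k → recip k * harmonic n k hi)
harmonic-by-head n lo hi = trans
  (sumIncreasing-cong (suc n) lo hi {λ ks → recip (∏ ks)} {λ ks → recip (head ks) * recip (∏ (tail ks))}
    (λ { (k ∷ ks) → recip-homo-* k (∏ ks) }))
  (sumIncreasing-by-head n lo hi recip)

harmonic-head : ∀ n lo hi → suc lo < hi →
  harmonic (suc n) lo hi ≡ recip (suc lo) * harmonic n (suc lo) hi + harmonic (suc n) (suc lo) hi
harmonic-head n lo hi 1+lo<hi = trans (harmonic-by-head n lo hi)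
  (trans (sumBetween-head lo hi (λ k → recip k * harmonic n k hi) 1+lo<hi)
    (cong (λ x → recip (suc lo) * harmonic n (suc lo) hi + x) (sym (harmonic-by-head n (suc lo) hi))))

harmonic-last : ∀ n lo hi → lo < hi →
  harmonic (suc n) lo (suc hi) ≡ harmonic (suc n) lo hi + recip hi * harmonic n lo hi
harmonic-last n lo hi lo<hi = trans (sumIncreasing-last n lo hi (λ ks → recip (∏ ks)) lo<hi)
  (cong (harmonic (suc n) lo hi +_) (trans
    (sumIncreasing-cong n lo hi (λ ks → trans (cong recip (trans (∏-∷ʳ ks hi) (ℕ.*-comm (∏ ks) hi))) (recip-homo-* hi (∏ ks))))
    (sumIncreasing-* n lo hi (recip hi) (λ ks → recip (∏ ks)))))

-- Passing from the eigenvalue -1 to the eigenvalue 1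

binomialTransform≡ : ∀ a r → binomialTransform a r ≡ ∑[ k < suc r ] (⟦ r C toℕ k ⟧ * sg (toℕ k) * a (toℕ k))
binomialTransform≡ a r = ∑-cong (λ k → (ℤ.+ (r C k) / 1) * sg k * a k) (λ k → ⟦ r C k ⟧ * sg k * a k) (suc r)
  (λ k _ → cong (λ c → c * sg k * a k) (n/1≡⟦n⟧ (r C k)))

𝒮₋⇒a₀≡0 : ∀ a → 𝒮₋ a → a 0 ≡ 0ℚ
𝒮₋⇒a₀≡0 a a∈𝒮₋ = begin
  a 0                                          ≡⟨ solve 1 (λ x → x := con ½ :* (x :+ x)) refl (a 0) ⟩
  ½ * (a 0 + a 0)                              ≡⟨ cong (λ x → ½ * (x + a 0)) (trans (sym transform₀) (a∈𝒮₋ 0)) ⟩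
  ½ * (- a 0 + a 0)                            ≡⟨ solve 1 (λ x → con ½ :* (:- x :+ x) := con 0ℚ) refl (a 0) ⟩
  0ℚ                                           ∎
  where
  open ≡-Reasoning
  transform₀ : binomialTransform a 0 ≡ a 0
  transform₀ = solve 1 (λ x → con 1ℚ :* x :+ con 0ℚ := x) refl (a 0)

-- Absorption, C(r, k)/(k + 1) = C(r+1, k+1)/(r + 1), turns the transform of the new sequence at r
-- into that of `a` at r + 1; the shift of k flips the sign and with it the eigenvalue.
𝒮₋⇒𝒮₊ : ∀ a → 𝒮₋ a → 𝒮₊ (λ j → recip (suc j) * a (suc j))
𝒮₋⇒𝒮₊ a a∈𝒮₋ r = begin
  binomialTransform b r
    ≡⟨ binomialTransform≡ b r ⟩
  T
    ≡⟨ *-identityˡ T ⟨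
  1ℚ * T
    ≡⟨ cong (_* T) (recip-inverse r) ⟨
  recip (suc r) * ⟦ suc r ⟧ * T
    ≡⟨ *-assoc (recip (suc r)) ⟦ suc r ⟧ T ⟩
  recip (suc r) * (⟦ suc r ⟧ * T)
    ≡⟨ cong (recip (suc r) *_) scaled ⟩
  recip (suc r) * a (suc r) ∎
  where
  open ≡-Reasoning
  b = λ j → recip (suc j) * a (suc j)
  t u : ℕ → ℚ
  t k = ⟦ r C k ⟧ * sg k * b k
  u k = ⟦ suc r C k ⟧ * sg k * a k
  T = ∑[ k < suc r ] t (toℕ k)
  term : ∀ k → ⟦ suc r ⟧ * t k ≡ - 1ℚ * u (suc k)
  term k = begin
    ⟦ suc r ⟧ * (⟦ r C k ⟧ * sg k * (recip (suc k) * a (suc k)))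
      ≡⟨ solve 5 (λ n c s w x → n :* (c :* s :* (w :* x)) := n :* c :* (s :* (w :* x))) refl ⟦ suc r ⟧ ⟦ r C k ⟧ (sg k) (recip (suc k)) (a (suc k)) ⟩
    ⟦ suc r ⟧ * ⟦ r C k ⟧ * (sg k * (recip (suc k) * a (suc k)))
      ≡⟨ cong (_* (sg k * (recip (suc k) * a (suc k)))) absorb ⟩
    ⟦ suc k ⟧ * ⟦ suc r C suc k ⟧ * (sg k * (recip (suc k) * a (suc k)))
      ≡⟨ solve 5 (λ n c s w x → n :* c :* (s :* (w :* x)) := w :* n :* (c :* s :* x)) refl ⟦ suc k ⟧ ⟦ suc r C suc k ⟧ (sg k) (recip (suc k)) (a (suc k)) ⟩
    recip (suc k) * ⟦ suc k ⟧ * (⟦ suc r C suc k ⟧ * sg k * a (suc k))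
      ≡⟨ cong (_* (⟦ suc r C suc k ⟧ * sg k * a (suc k))) (recip-inverse k) ⟩
    1ℚ * (⟦ suc r C suc k ⟧ * sg k * a (suc k))
      ≡⟨ solve 3 (λ c s x → con 1ℚ :* (c :* s :* x) := con (- 1ℚ) :* (c :* (con (- 1ℚ) :* s) :* x)) refl ⟦ suc r C suc k ⟧ (sg k) (a (suc k)) ⟩
    - 1ℚ * u (suc k) ∎
    where
    absorb : ⟦ suc r ⟧ * ⟦ r C k ⟧ ≡ ⟦ suc k ⟧ * ⟦ suc r C suc k ⟧
    absorb = trans (sym (ℚ∑.⟦⟧-homo-* (suc r) (r C k)))
      (trans (cong ⟦_⟧ (sym ([1+k]*[1+n]C[1+k]≡[1+n]*nCk r k))) (ℚ∑.⟦⟧-homo-* (suc k) (suc r C suc k)))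
  scaled : ⟦ suc r ⟧ * T ≡ a (suc r)
  scaled = begin
    ⟦ suc r ⟧ * T
      ≡⟨ ℚ∑.*-distribˡ-sum {suc r} ⟦ suc r ⟧ (λ k → t (toℕ k)) ⟩
    ∑[ k < suc r ] (⟦ suc r ⟧ * t (toℕ k))
      ≡⟨ ∑-cong (λ k → ⟦ suc r ⟧ * t k) (λ k → - 1ℚ * u (suc k)) (suc r) (λ k _ → term k) ⟩
    ∑[ k < suc r ] (- 1ℚ * u (suc (toℕ k)))
      ≡⟨ ℚ∑.*-distribˡ-sum {suc r} (- 1ℚ) (λ k → u (suc (toℕ k))) ⟨
    - 1ℚ * U
      -- The shifted sum lacks the term k = 0 of the transform at r + 1. It is restored as
      -- `1ℚ * 1ℚ * 0ℚ`, which matches `u 0` because `a 0` is 0.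
      ≡⟨ solve 1 (λ x → con (- 1ℚ) :* x := :- (con 1ℚ :* con 1ℚ :* con 0ℚ :+ x)) refl U ⟩
    - (1ℚ * 1ℚ * 0ℚ + U)
      ≡⟨ cong (λ x → - (1ℚ * 1ℚ * x + U)) (𝒮₋⇒a₀≡0 a a∈𝒮₋) ⟨
    - ∑[ k < suc (suc r) ] u (toℕ k)
      ≡⟨ cong -_ (trans (sym (binomialTransform≡ a (suc r))) (a∈𝒮₋ (suc r))) ⟩
    - (- a (suc r))
      ≡⟨ solve 1 (λ x → :- (:- x) := x) refl (a (suc r)) ⟩
    a (suc r) ∎
    where U = ∑[ k < suc r ] u (suc (toℕ k))

-- p-integral rationals and their residues

module _ {p : ℕ} (p-prime : Prime p) where

  p∣i⇒p∣i*j : ∀ i j {k} → i ℤ.* j ≡ k → p ∣ ℤ.∣ i ∣ → p ∣ ℤ.∣ k ∣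
  p∣i⇒p∣i*j i j refl p∣i = ∣-trans p∣i (subst (ℤ.∣ i ∣ ∣_) (sym (ℤ.abs-* i j)) (m∣m*n ℤ.∣ j ∣))

  -- Here `c` is the factor cancelled when a sum or product is reduced to lowest terms. A prime
  -- dividing the reduced denominator divides the product of the two old ones, and Euclid's lemma
  -- applies.
  ∤-denominators : ∀ {x y z c} → ↧ z ℤ.* c ≡ ↧ x ℤ.* ↧ y → p -integral x → p -integral y → p -integral z
  ∤-denominators {x} {y} {z} {c} eq ix iy p∣z = [ ix , iy ]′ (euclidsLemma (↧ₙ x) (↧ₙ y) p-prime
    (subst (p ∣_) (ℤ.abs-* (↧ x) (↧ y)) (p∣i⇒p∣i*j (↧ z) c eq p∣z)))

  integral-+ : ∀ {x y} → p -integral x → p -integral y → p -integral (x + y)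
  integral-+ {x} {y} = ∤-denominators {x} {y} {x + y} (↧-+ x y)

  integral-* : ∀ {x y} → p -integral x → p -integral y → p -integral (x * y)
  integral-* {x} {y} = ∤-denominators {x} {y} {x * y} (↧-* x y)

  integral-neg : ∀ {x} → p -integral x → p -integral (- x)
  integral-neg {x} ix p∣-x = ix (subst (p ∣_) (cong ℤ.∣_∣ (↧-neg x)) p∣-x)

  integral-0 : p -integral 0ℚ
  integral-0 p∣1 = ¬prime[1] (subst Prime (∣1⇒≡1 p∣1) p-prime)

  integral-1 : p -integral 1ℚ
  integral-1 p∣1 = ¬prime[1] (subst Prime (∣1⇒≡1 p∣1) p-prime)

  opaque
    unfolding recip

    integral-recip : ∀ {d} → 0 < d → d < p → p -integral (recip d)
    integral-recip {suc d} _ 1+d<p = integral-* {1ℚ} {ℤ.+ 1 / suc d} integral-1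
      (λ p∣↧ → >⇒∤ 1+d<p (p∣i⇒p∣i*j (↧ (ℤ.+ 1 / suc d)) (gcd (ℤ.+ 1) (ℤ.+ suc d)) (↧-/ (ℤ.+ 1) (suc d)) p∣↧))

  integral-∑ : ∀ (f : ℕ → ℚ) n → (∀ i → i < n → p -integral (f i)) → p -integral (∑[ i < n ] f (toℕ i))
  integral-∑ f zero    if = integral-0
  integral-∑ f (suc n) if = integral-+ {f 0} (if 0 (s≤s z≤n)) (integral-∑ (λ i → f (suc i)) n (λ i i<n → if (suc i) (s≤s i<n)))

  integral-harmonic : ∀ n lo hi → hi ≤ p → p -integral (harmonic n lo hi)
  integral-harmonic zero lo hi hi≤p = subst (p -integral_) (sym recip-1) integral-1
  integral-harmonic (suc n) lo hi hi≤p = subst (p -integral_) (sym (harmonic-by-head n lo hi))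
    (integral-∑ (λ i → recip (suc lo ℕ.+ i) * harmonic n (suc lo ℕ.+ i) hi) (hi ∸ suc lo) (λ i i<hi∸1+lo →
      integral-* {recip (suc lo ℕ.+ i)} (integral-recip (s≤s z≤n) (ℕ.<-≤-trans (m<n∸o⇒o+m<n i hi (suc lo) i<hi∸1+lo) hi≤p))
        (integral-harmonic n (suc lo ℕ.+ i) hi hi≤p)))

  -- The residue field is the ring of p-integral rationals with congruence as its equality. First
  -- components remain the rational numbers themselves, so a sum of residues projects to the
  -- corresponding sum in ℚ.
  Residue : Set
  Residue = ∃ (p -integral_)

  infixl 6 _+ᴿ_
  infixl 7 _*ᴿ_
  infix  8 -ᴿ_

  _+ᴿ_ _*ᴿ_ : Residue → Residue → Residue
  (x , ix) +ᴿ (y , iy) = x + y , integral-+ {x} {y} ix iy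
  (x , ix) *ᴿ (y , iy) = x * y , integral-* {x} {y} ix iy

  -ᴿ_ : Residue → Residue
  -ᴿ (x , ix) = - x , integral-neg {x} ix

  infix 4 _≈_
  record _≈_ (x y : Residue) : Set where
    constructor congruent
    field
      quotient : ℚ
      quotient-integral : p -integral quotient
      difference : proj₁ x - proj₁ y ≡ ⟦ p ⟧ * quotient

  ≡⇒≈ : ∀ {x y} → proj₁ x ≡ proj₁ y → x ≈ y
  ≡⇒≈ {x , _} refl = congruent 0ℚ integral-0 (trans (+-inverseʳ x) (sym (*-zeroʳ ⟦ p ⟧)))

  residueRing : CommutativeRing 0ℓ 0ℓ
  residueRing = record
    { Carrier = Residue
    ; _≈_ = _≈_
    ; _+_ = _+ᴿ_
    ; _*_ = _*ᴿ_
    ; -_ = -ᴿ_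
    ; 0# = 0ℚ , integral-0
    ; 1# = 1ℚ , integral-1
    ; isCommutativeRing = record
      { isRing = record
        { +-isAbelianGroup = record
          { isGroup = record
            { isMonoid = record
              { isSemigroup = record
                { isMagma = record
                  { isEquivalence = record
                    { refl = ≡⇒≈ refl
                    ; sym = ≈-sym
                    ; trans = ≈-trans
                    }
                  ; ∙-cong = +ᴿ-cong
                  }
                ; assoc = λ (x , _) (y , _) (z , _) → ≡⇒≈ (+-assoc x y z)
                }
              ; identity = (λ (x , _) → ≡⇒≈ (+-identityˡ x)) , (λ (x , _) → ≡⇒≈ (+-identityʳ x))
              }
            ; inverse = (λ (x , _) → ≡⇒≈ (+-inverseˡ x)) , (λ (x , _) → ≡⇒≈ (+-inverseʳ x))
            ; ⁻¹-cong = -ᴿ-cong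
            }
          ; comm = λ (x , _) (y , _) → ≡⇒≈ (+-comm x y)
          }
        ; *-cong = *ᴿ-cong
        ; *-assoc = λ (x , _) (y , _) (z , _) → ≡⇒≈ (*-assoc x y z)
        ; *-identity = (λ (x , _) → ≡⇒≈ (*-identityˡ x)) , (λ (x , _) → ≡⇒≈ (*-identityʳ x))
        ; distrib = (λ (x , _) (y , _) (z , _) → ≡⇒≈ (*-distribˡ-+ x y z)) , (λ (x , _) (y , _) (z , _) → ≡⇒≈ (*-distribʳ-+ x y z))
        }
      ; *-comm = λ (x , _) (y , _) → ≡⇒≈ (*-comm x y)
      }
    }
    where
    ≈-sym : ∀ {x y} → x ≈ y → y ≈ x
    ≈-sym {x , _} {y , _} (congruent z iz eq) = congruent (- z) (integral-neg {z} iz)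
      (trans (solve 2 (λ x y → y :- x := :- (x :- y)) refl x y)
        (trans (cong -_ eq) (solve 2 (λ q z → :- (q :* z) := q :* :- z) refl ⟦ p ⟧ z)))

    ≈-trans : ∀ {x y z} → x ≈ y → y ≈ z → x ≈ z
    ≈-trans {x , _} {y , _} {z , _} (congruent u iu eq) (congruent v iv eq′) = congruent (u + v) (integral-+ {u} {v} iu iv)
      (trans (solve 3 (λ x y z → x :- z := (x :- y) :+ (y :- z)) refl x y z)
        (trans (cong₂ _+_ eq eq′) (sym (*-distribˡ-+ ⟦ p ⟧ u v))))

    +ᴿ-cong : ∀ {x y u v} → x ≈ y → u ≈ v → x +ᴿ u ≈ y +ᴿ v
    +ᴿ-cong {x , _} {y , _} {u , _} {v , _} (congruent s is eq) (congruent t it eq′) = congruent (s + t) (integral-+ {s} {t} is it)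
      (trans (solve 4 (λ x y u v → x :+ u :- (y :+ v) := (x :- y) :+ (u :- v)) refl x y u v)
        (trans (cong₂ _+_ eq eq′) (sym (*-distribˡ-+ ⟦ p ⟧ s t))))

    -ᴿ-cong : ∀ {x y} → x ≈ y → -ᴿ x ≈ -ᴿ y
    -ᴿ-cong {x , _} {y , _} (congruent z iz eq) = congruent (- z) (integral-neg {z} iz)
      (trans (solve 2 (λ x y → :- x :- :- y := :- (x :- y)) refl x y)
        (trans (cong -_ eq) (solve 2 (λ q z → :- (q :* z) := q :* :- z) refl ⟦ p ⟧ z)))

    *ᴿ-cong : ∀ {x y u v} → x ≈ y → u ≈ v → x *ᴿ u ≈ y *ᴿ v
    *ᴿ-cong {x , ix} {y , iy} {u , iu} {v , iv} (congruent s is eq) (congruent t it eq′) = congruent (s * u + y * t)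
      (integral-+ {s * u} {y * t} (integral-* {s} {u} is iu) (integral-* {y} {t} iy it))
      (trans (solve 4 (λ x y u v → x :* u :- y :* v := (x :- y) :* u :+ y :* (u :- v)) refl x y u v)
        (trans (cong₂ (λ a b → a * u + y * b) eq eq′)
          (solve 5 (λ q s u y t → q :* s :* u :+ y :* (q :* t) := q :* (s :* u :+ y :* t)) refl ⟦ p ⟧ s u y t)))

odd⇒half : ∀ n → ¬ (2 ∣ suc n) → ∃ λ t → n ≡ t ℕ.+ t
odd⇒half zero          2∤ = 0 , refl
odd⇒half (suc zero)    2∤ = contradiction ∣-refl 2∤
odd⇒half (suc (suc n)) 2∤ with t , n≡t+t ← odd⇒half n (λ 2∣ → 2∤ (∣m∣n⇒∣m+n ∣-refl 2∣)) =
  suc t , cong suc (trans (cong suc n≡t+t) (sym (ℕ.+-suc t t)))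

2+m∸[1+m∸n]≡1+n : ∀ {m n} → n ≤ m → 2 ℕ.+ m ∸ (suc m ∸ n) ≡ suc n
2+m∸[1+m∸n]≡1+n {m} {n} n≤m = trans (ℕ.+-∸-assoc 1 (ℕ.m∸n≤m (suc m) n))
  (cong suc (ℕ.m∸[m∸n]≡n (ℕ.m≤n⇒m≤1+n n≤m)))

-- When the two denominators add up to p, the right side is a multiple of p: the reciprocals of k
-- and p - k are opposite modulo p.
recip-+ : ∀ m n → recip (suc m) + recip (suc n) ≡ ⟦ suc m ℕ.+ suc n ⟧ * (recip (suc m) * recip (suc n))
recip-+ m n = begin
  x + y                          ≡⟨ solve 2 (λ x y → x :+ y := x :* con 1ℚ :+ y :* con 1ℚ) refl x y ⟩
  x * 1ℚ + y * 1ℚ                ≡⟨ cong₂ (λ u v → x * u + y * v) (recip-inverse n) (recip-inverse m) ⟨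
  x * (y * b) + y * (x * a)      ≡⟨ solve 4 (λ x y a b → x :* (y :* b) :+ y :* (x :* a) := (a :+ b) :* (x :* y)) refl x y a b ⟩
  (a + b) * (x * y)              ≡⟨ cong (_* (x * y)) (ℚ∑.⟦⟧-homo-+ (suc m) (suc n)) ⟨
  ⟦ suc m ℕ.+ suc n ⟧ * (x * y)  ∎
  where
  open ≡-Reasoning
  x = recip (suc m)
  y = recip (suc n)
  a = ⟦ suc m ⟧
  b = ⟦ suc n ⟧

-- The coefficient sequences modulo p = M + 2

module _ {M : ℕ} (p-prime : Prime (2 ℕ.+ M)) where

  p : ℕ
  p = 2 ℕ.+ M

  open CommutativeRing (residueRing p-prime) using (setoid; 0#; 1#) renaming
    ( Carrier to 𝔽; _+_ to _⊕_; _*_ to _⊗_; _≈_ to _≋_; refl to ≋-refl; sym to ≋-sym; trans to ≋-trans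
    ; *-cong to ⊗-cong; *-congʳ to ⊗-congʳ; *-congˡ to ⊗-congˡ; *-identityˡ to ⊗-identityˡ; *-assoc to ⊗-assoc
    ; +-congˡ to ⊕-congˡ; +-identityʳ to ⊕-identityʳ; distribˡ to ⊗-distribˡ-⊕; zeroʳ to ⊗-zeroʳ)
  module 𝔽∑ = CommutativeRingSums (residueRing p-prime)

  ⟦⟧-residue : ∀ n → proj₁ 𝔽∑.⟦ n ⟧ ≡ ⟦ n ⟧
  ⟦⟧-residue zero    = refl
  ⟦⟧-residue (suc n) = cong (λ x → 1ℚ + x) (⟦⟧-residue n)

  sg-residue : ∀ k → proj₁ (𝔽∑.sg k) ≡ sg k
  sg-residue zero    = refl
  sg-residue (suc k) = cong (λ x → - 1ℚ * x) (sg-residue k)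

  ∑-residue : ∀ (f : ℕ → 𝔽) n → proj₁ (𝔽∑.sum-syntax n (λ i → f (toℕ i))) ≡ ∑[ i < n ] proj₁ (f (toℕ i))
  ∑-residue f zero    = refl
  ∑-residue f (suc n) = cong (λ x → proj₁ (f 0) + x) (∑-residue (λ i → f (suc i)) n)

  characteristic : 𝔽∑.⟦ p ⟧ ≋ 0#
  characteristic = congruent 1ℚ (integral-1 p-prime) (trans (cong (_- 0ℚ) (⟦⟧-residue p))
    (solve 1 (λ x → x :- con 0ℚ := x :* con 1ℚ) refl ⟦ p ⟧))

  -- Since k < M means 2 + k < p, the rational inverse of 2 + k is p-integral.
  ⟦⟧-cancel : ∀ k x y → k < M → 𝔽∑.⟦ 2 ℕ.+ k ⟧ ⊗ x ≋ 𝔽∑.⟦ 2 ℕ.+ k ⟧ ⊗ y → x ≋ y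
  ⟦⟧-cancel k x y k<M eq = ≋-trans (≋-sym (undo x)) (≋-trans (⊗-congˡ {inverse} eq) (undo y))
    where
    inverse : 𝔽
    inverse = recip (2 ℕ.+ k) , integral-recip p-prime (s≤s z≤n) (s≤s (s≤s k<M))
    undo : ∀ z → inverse ⊗ (𝔽∑.⟦ 2 ℕ.+ k ⟧ ⊗ z) ≋ z
    undo z = ≋-trans (≋-sym (⊗-assoc inverse 𝔽∑.⟦ 2 ℕ.+ k ⟧ z)) (≋-trans
      (⊗-congʳ {z} (≡⇒≈ p-prime {inverse ⊗ 𝔽∑.⟦ 2 ℕ.+ k ⟧} {1#} (trans (cong (recip (2 ℕ.+ k) *_) (⟦⟧-residue (2 ℕ.+ k))) (recip-inverse (suc k)))))
      (⊗-identityˡ z))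

  -- upper n is the coefficient sequence of Qₙ₊₁; lower is its image under kᵢ ↦ p − kᵢ.
  upper lower : ℕ → ℕ → 𝔽
  upper n k = harmonic n (suc k) p , integral-harmonic p-prime n (suc k) p ℕ.≤-refl
  lower n k = harmonic n 0 (suc M ∸ k) , integral-harmonic p-prime n 0 (suc M ∸ k) (ℕ.m≤n⇒m≤1+n (ℕ.m∸n≤m (suc M) k))

  -- This one is exact in ℚ: either the smallest index is 2 + k, whose reciprocal the factor 2 + k
  -- clears, or it is larger.
  upper-rec : ∀ n k → k < M →
    𝔽∑.⟦ 2 ℕ.+ k ⟧ ⊗ upper (suc n) k ≋ (𝔽∑.⟦ 2 ℕ.+ k ⟧ ⊗ upper (suc n) (suc k)) ⊕ upper n (suc k)
  upper-rec n k k<M = ≡⇒≈ p-prime (begin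
    proj₁ 𝔽∑.⟦ 2 ℕ.+ k ⟧ * harmonic (suc n) (suc k) p
      ≡⟨ cong₂ _*_ (⟦⟧-residue (2 ℕ.+ k)) (harmonic-head n (suc k) p (s≤s (s≤s k<M))) ⟩
    K * (w * h + h′)
      ≡⟨ solve 4 (λ k w h h′ → k :* (w :* h :+ h′) := k :* h′ :+ w :* k :* h) refl K w h h′ ⟩
    K * h′ + w * K * h
      ≡⟨ cong₂ (λ x y → x * h′ + y * h) (sym (⟦⟧-residue (2 ℕ.+ k))) (recip-inverse (suc k)) ⟩
    proj₁ 𝔽∑.⟦ 2 ℕ.+ k ⟧ * h′ + 1ℚ * h
      ≡⟨ cong (λ x → proj₁ 𝔽∑.⟦ 2 ℕ.+ k ⟧ * h′ + x) (*-identityˡ h) ⟩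
    proj₁ 𝔽∑.⟦ 2 ℕ.+ k ⟧ * h′ + h ∎)
    where
    open ≡-Reasoning
    K = ⟦ 2 ℕ.+ k ⟧
    w = recip (2 ℕ.+ k)
    h = harmonic n (2 ℕ.+ k) p
    h′ = harmonic (suc n) (2 ℕ.+ k) p


  -- The recursion of lower involves 1/(p − 2 − k), which is −1/(2 + k) modulo p.
  lower-rec : ∀ n k → k < M →
    (𝔽∑.⟦ 2 ℕ.+ k ⟧ ⊗ lower (suc n) k) ⊕ lower n (suc k) ≋ 𝔽∑.⟦ 2 ℕ.+ k ⟧ ⊗ lower (suc n) (suc k)
  lower-rec n k k<M = congruent (h * w)
    (integral-* p-prime {h} {w} (integral-harmonic p-prime n 0 j (ℕ.m≤n⇒m≤o+n 2 (ℕ.m∸n≤m M k)))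
      (integral-recip p-prime 0<j (s≤s (ℕ.m≤n⇒m≤1+n (ℕ.m∸n≤m M k)))))
    (begin
    proj₁ 𝔽∑.⟦ 2 ℕ.+ k ⟧ * harmonic (suc n) 0 (suc M ∸ k) + h - proj₁ 𝔽∑.⟦ 2 ℕ.+ k ⟧ * h′
      ≡⟨ cong₂ (λ x i → x * harmonic (suc n) 0 i + h - x * h′) (⟦⟧-residue (2 ℕ.+ k)) (ℕ.+-∸-assoc 1 (ℕ.<⇒≤ k<M)) ⟩
    K * harmonic (suc n) 0 (suc j) + h - K * h′
      ≡⟨ cong (λ x → K * x + h - K * h′) (harmonic-last n 0 j 0<j) ⟩
    K * (h′ + w * h) + h - K * h′
      ≡⟨ solve 4 (λ k h h′ w → k :* (h′ :+ w :* h) :+ h :- k :* h′ := h :* (k :* w :+ con 1ℚ)) refl K h h′ w ⟩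
    h * (K * w + 1ℚ)
      ≡⟨ cong (λ x → h * (K * w + x)) inverse ⟨
    h * (K * w + w * ⟦ j ⟧)
      ≡⟨ solve 4 (λ k h w c → h :* (k :* w :+ w :* c) := (k :+ c) :* (h :* w)) refl K h w ⟦ j ⟧ ⟩
    (K + ⟦ j ⟧) * (h * w)
      ≡⟨ cong (_* (h * w)) (trans (sym (ℚ∑.⟦⟧-homo-+ (2 ℕ.+ k) j)) (cong ⟦_⟧ (cong (2 ℕ.+_) (ℕ.m+[n∸m]≡n (ℕ.<⇒≤ k<M))))) ⟩
    ⟦ p ⟧ * (h * w) ∎)
    where
    open ≡-Reasoning
    j = M ∸ k
    0<j : 0 < j
    0<j = ℕ.m<n⇒0<n∸m k<M
    K = ⟦ 2 ℕ.+ k ⟧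
    w = recip j
    h = harmonic n 0 j
    h′ = harmonic (suc n) 0 j
    inverse : w * ⟦ j ⟧ ≡ 1ℚ
    inverse = subst (λ i → recip i * ⟦ i ⟧ ≡ 1ℚ) (ℕ.suc-pred j {{ℕ.>-nonZero 0<j}}) (recip-inverse (ℕ.pred j))

  upper-zero : ∀ k → upper 0 k ≋ 1#
  upper-zero k = ≡⇒≈ p-prime recip-1

  lower-zero : ∀ k → lower 0 k ≋ 1#
  lower-zero k = ≡⇒≈ p-prime recip-1

  upper-last : ∀ n → upper (suc n) M ≋ 0#
  upper-last n = ≡⇒≈ p-prime (sumIncreasing-empty n (suc M) p (λ ks → recip (∏ ks)) ℕ.≤-refl)

  lower-last : ∀ n → lower (suc n) M ≋ 0#
  lower-last n = ≡⇒≈ p-prime (sumIncreasing-empty n 0 (suc M ∸ M) (λ ks → recip (∏ ks))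
    (ℕ.≤-reflexive (ℕ.m+n∸n≡m 1 M)))

  -- Only the first 1 + M values of a are known to be integral.
  residues : (a : ℕ → ℚ) → (∀ k → k ≤ M → (p -integral a k)) → ℕ → 𝔽
  residues a ia j = a (j ⊓ M) , ia (j ⊓ M) (ℕ.m⊓n≤n j M)

  ≋⇒mod : ∀ x y → x ≋ y → proj₁ x ≡ proj₁ y [mod p ]
  ≋⇒mod x y (congruent z iz eq) = subst (p -integral_) (sym quotient≡z) iz
    where
    open ≡-Reasoning
    quotient≡z : (proj₁ x - proj₁ y) /ₙ p ≡ z
    quotient≡z = begin
      (proj₁ x - proj₁ y) /ₙ p           ≡⟨ /ₙ≡*recip (proj₁ x - proj₁ y) p ⟩
      (proj₁ x - proj₁ y) * recip p      ≡⟨ cong (_* recip p) eq ⟩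
      ⟦ p ⟧ * z * recip p                ≡⟨ solve 3 (λ q z r → q :* z :* r := z :* (r :* q)) refl ⟦ p ⟧ z (recip p) ⟩
      z * (recip p * ⟦ p ⟧)              ≡⟨ cong (z *_) (recip-inverse (suc M)) ⟩
      z * 1ℚ                             ≡⟨ *-identityʳ z ⟩
      z                                  ∎

  both≡0 : ∀ {A B} x y → A ≡ proj₁ x → B ≡ proj₁ y → x ≋ 0# → y ≋ 0# → (A ≡ B [mod p ]) × (B ≡ 0ℚ [mod p ])
  both≡0 x y refl refl x≋0 y≋0 = ≋⇒mod x y (≋-trans x≋0 (≋-sym y≋0)) , ≋⇒mod y 0# y≋0

  sum-by-head : ∀ n (a : ℕ → ℚ) →
    sumIncreasing (suc n) 0 p (λ ks → a (head ks ∸ 1) * recip (∏ (tail ks)))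
      ≡ ∑[ j < suc M ] (proj₁ (upper n (toℕ j)) * a (toℕ j))
  sum-by-head n a = trans (sumIncreasing-by-head n 0 p (λ k → a (k ∸ 1)))
    (∑-cong (λ j → a j * harmonic n (suc j) p) (λ j → harmonic n (suc j) p * a j) (suc M)
      (λ j _ → *-comm (a j) (harmonic n (suc j) p)))

  -- Summing over j = p - 1 - kₙ pairs `lower n j` with the same entry of the sequence that
  -- `upper n j` multiplies in `sum-by-head`.
  sum-by-last : ∀ n (h : ℕ → ℚ) →
    sumIncreasing (suc n) 0 p (λ ks → h (last ks) * recip (∏ (init ks)))
      ≡ ∑[ j < suc M ] (proj₁ (lower n (toℕ j)) * h (suc M ∸ toℕ j))
  sum-by-last n h = begin
    sumIncreasing (suc n) 0 p (λ ks → h (last ks) * recip (∏ (init ks)))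
      ≡⟨ sumIncreasing-by-last n p h ⟩
    ∑[ j < suc M ] f (toℕ j)
      ≡⟨ ℚ∑.∑-reverse f M ⟩
    ∑[ j < suc M ] f (M ∸ toℕ j)
      ≡⟨ ∑-cong (λ j → f (M ∸ j)) (λ j → harmonic n 0 (suc M ∸ j) * h (suc M ∸ j)) (suc M) term ⟩
    ∑[ j < suc M ] (harmonic n 0 (suc M ∸ toℕ j) * h (suc M ∸ toℕ j)) ∎
    where
    open ≡-Reasoning
    f : ℕ → ℚ
    f j = h (suc j) * harmonic n 0 (suc j)
    term : ∀ j → j < suc M → f (M ∸ j) ≡ harmonic n 0 (suc M ∸ j) * h (suc M ∸ j)
    term j j<1+M = trans (cong (λ i → h i * harmonic n 0 i) (sym (ℕ.+-∸-assoc 1 (ℕ.≤-pred j<1+M))))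
      (*-comm (h (suc M ∸ j)) (harmonic n 0 (suc M ∸ j)))

  -- Vanishing of the weighted sums for odd p and n = 2u + 1

  module _ {t : ℕ} (odd : suc M ≡ t ℕ.+ t) (0<M : 0 < M) (u : ℕ) where

    m : ℕ
    m = u ℕ.+ u

    weighted : (ℕ → 𝔽) → (ℕ → 𝔽) → 𝔽
    weighted h a = 𝔽∑.sum-syntax (suc M) (λ j → h (toℕ j) ⊗ a (toℕ j))

    weighted-residues : ∀ h a ia → proj₁ (weighted h (residues a ia)) ≡ ∑[ j < suc M ] (proj₁ (h (toℕ j)) * a (toℕ j))
    weighted-residues h a ia = trans (∑-residue (λ j → h j ⊗ residues a ia j) (suc M))
      (∑-cong (λ j → proj₁ (h j) * a (j ⊓ M)) (λ j → proj₁ (h j) * a j) (suc M)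
        (λ j j<1+M → cong (λ i → proj₁ (h j) * a i) (ℕ.m≤n⇒m⊓n≡m (ℕ.≤-pred j<1+M))))

    upper≋0 : ∀ a ia → 𝒮₊ a → weighted (upper m) (residues a ia) ≋ 0#
    upper≋0 a ia a∈𝒮₊ = 𝔽∑.∑-invariant≈0 M characteristic ⟦⟧-cancel upper upper-zero upper-last upper-rec
      (≋-trans (≡⇒≈ p-prime (cong (λ n → proj₁ (𝔽∑.sg n)) odd)) (𝔽∑.sg-double t)) 0<M u (residues a ia)
      (λ r r≤M → ≡⇒≈ p-prime (invariant r r≤M))
      where
      open ≡-Reasoning
      invariant : ∀ r → r ≤ M →
        proj₁ (𝔽∑.sum-syntax (suc r) (λ k → (𝔽∑.⟦ r C toℕ k ⟧ ⊗ 𝔽∑.sg (toℕ k)) ⊗ residues a ia (toℕ k))) ≡ a (r ⊓ M)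
      invariant r r≤M = begin
        proj₁ (𝔽∑.sum-syntax (suc r) (λ k → (𝔽∑.⟦ r C toℕ k ⟧ ⊗ 𝔽∑.sg (toℕ k)) ⊗ residues a ia (toℕ k)))
          ≡⟨ ∑-residue (λ k → (𝔽∑.⟦ r C k ⟧ ⊗ 𝔽∑.sg k) ⊗ residues a ia k) (suc r) ⟩
        ∑[ k < suc r ] (proj₁ 𝔽∑.⟦ r C toℕ k ⟧ * proj₁ (𝔽∑.sg (toℕ k)) * a (toℕ k ⊓ M))
          ≡⟨ ∑-cong (λ k → proj₁ 𝔽∑.⟦ r C k ⟧ * proj₁ (𝔽∑.sg k) * a (k ⊓ M)) (λ k → ⟦ r C k ⟧ * sg k * a k) (suc r)
               (λ k k<1+r → cong₂ _*_ (cong₂ _*_ (⟦⟧-residue (r C k)) (sg-residue k))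
                 (cong a (ℕ.m≤n⇒m⊓n≡m (ℕ.≤-trans (ℕ.≤-pred k<1+r) r≤M)))) ⟩
        ∑[ k < suc r ] (⟦ r C toℕ k ⟧ * sg (toℕ k) * a (toℕ k))
          ≡⟨ binomialTransform≡ a r ⟨
        binomialTransform a r
          ≡⟨ a∈𝒮₊ r ⟩
        a r
          ≡⟨ cong a (ℕ.m≤n⇒m⊓n≡m r≤M) ⟨
        a (r ⊓ M) ∎

    -- The reflection costs the sign (-1)ᵐ, and m = n - 1 is even.
    lower≋upper : ∀ j → j ≤ M → lower m j ≋ upper m j
    lower≋upper j j≤M = ≋-trans
      (𝔽∑.reflected M characteristic ⟦⟧-cancel upper upper-zero upper-last upper-rec
        lower lower-zero lower-last lower-rec m j j≤M)
      (≋-trans (⊗-congʳ {upper m j} (𝔽∑.sg-double u)) (⊗-identityˡ (upper m j)))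

    lower≋0 : ∀ a ia → 𝒮₊ a → weighted (lower m) (residues a ia) ≋ 0#
    lower≋0 a ia a∈𝒮₊ = ≋-trans
      (𝔽∑.∑-cong (λ j → lower m j ⊗ residues a ia j) (λ j → upper m j ⊗ residues a ia j) (suc M)
        (λ j j<1+M → ⊗-congʳ {residues a ia j} (lower≋upper j (ℕ.≤-pred j<1+M))))
      (upper≋0 a ia a∈𝒮₊)

    case₊ : ∀ a → 𝒮₊ a → (∀ k → k ≤ M → p -integral a k) →
      let A = sumIncreasing (suc m) 0 p (λ ks → a (p ∸ last ks ∸ 1) /ₙ ∏ (init ks))
          B = sumIncreasing (suc m) 0 p (λ ks → a (head ks ∸ 1) /ₙ ∏ (tail ks))
      in (A ≡ B [mod p ]) × (B ≡ 0ℚ [mod p ])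
    case₊ a a∈𝒮₊ ia = both≡0 (weighted (lower m) (residues a ia)) (weighted (upper m) (residues a ia))
      (begin
        sumIncreasing (suc m) 0 p (λ ks → a (p ∸ last ks ∸ 1) /ₙ ∏ (init ks))
          ≡⟨ sumIncreasing-cong (suc m) 0 p (λ ks → /ₙ≡*recip (a (p ∸ last ks ∸ 1)) (∏ (init ks))) ⟩
        sumIncreasing (suc m) 0 p (λ ks → a (p ∸ last ks ∸ 1) * recip (∏ (init ks)))
          ≡⟨ sum-by-last m (λ k → a (p ∸ k ∸ 1)) ⟩
        ∑[ j < suc M ] (proj₁ (lower m (toℕ j)) * a (p ∸ (suc M ∸ toℕ j) ∸ 1))
          ≡⟨ ∑-cong (λ j → proj₁ (lower m j) * a (p ∸ (suc M ∸ j) ∸ 1)) (λ j → proj₁ (lower m j) * a j) (suc M)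
               (λ j j<1+M → cong (λ i → proj₁ (lower m j) * a (i ∸ 1)) (2+m∸[1+m∸n]≡1+n (ℕ.≤-pred j<1+M))) ⟩
        ∑[ j < suc M ] (proj₁ (lower m (toℕ j)) * a (toℕ j))
          ≡⟨ weighted-residues (lower m) a ia ⟨
        proj₁ (weighted (lower m) (residues a ia)) ∎)
      (begin
        sumIncreasing (suc m) 0 p (λ ks → a (head ks ∸ 1) /ₙ ∏ (tail ks))
          ≡⟨ sumIncreasing-cong (suc m) 0 p (λ ks → /ₙ≡*recip (a (head ks ∸ 1)) (∏ (tail ks))) ⟩
        sumIncreasing (suc m) 0 p (λ ks → a (head ks ∸ 1) * recip (∏ (tail ks)))
          ≡⟨ sum-by-head m a ⟩
        ∑[ j < suc M ] (proj₁ (upper m (toℕ j)) * a (toℕ j))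
          ≡⟨ weighted-residues (upper m) a ia ⟨
        proj₁ (weighted (upper m) (residues a ia)) ∎)
      (lower≋0 a ia a∈𝒮₊) (upper≋0 a ia a∈𝒮₊)
      where open ≡-Reasoning

    case₋ : ∀ a → 𝒮₋ a → (∀ k → k ≤ suc M → p -integral a k) →
      let A = sumIncreasing (suc m) 0 p (λ ks → a (p ∸ last ks) /ₙ ∏ ks)
          B = sumIncreasing (suc m) 0 p (λ ks → a (head ks) /ₙ ∏ ks)
      in (A ≡ B [mod p ]) × (B ≡ 0ℚ [mod p ])
    case₋ a a∈𝒮₋ ia = both≡0 (weighted (lower m) (residues c ic)) (weighted (upper m) (residues b ib))
      (begin
        sumIncreasing (suc m) 0 p (λ ks → a (p ∸ last ks) /ₙ ∏ ks)
          ≡⟨ sumIncreasing-cong (suc m) 0 p (λ ks → split-last ks (a (p ∸ last ks))) ⟩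
        sumIncreasing (suc m) 0 p (λ ks → recip (last ks) * a (p ∸ last ks) * recip (∏ (init ks)))
          ≡⟨ sum-by-last m (λ k → recip k * a (p ∸ k)) ⟩
        ∑[ j < suc M ] (proj₁ (lower m (toℕ j)) * (recip (suc M ∸ toℕ j) * a (p ∸ (suc M ∸ toℕ j))))
          ≡⟨ ∑-cong (λ j → proj₁ (lower m j) * (recip (suc M ∸ j) * a (p ∸ (suc M ∸ j)))) (λ j → proj₁ (lower m j) * c j) (suc M)
               (λ j j<1+M → cong (λ i → proj₁ (lower m j) * (recip (suc M ∸ j) * a i)) (2+m∸[1+m∸n]≡1+n (ℕ.≤-pred j<1+M))) ⟩
        ∑[ j < suc M ] (proj₁ (lower m (toℕ j)) * c (toℕ j))
          ≡⟨ weighted-residues (lower m) c ic ⟨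
        proj₁ (weighted (lower m) (residues c ic)) ∎)
      (begin
        sumIncreasing (suc m) 0 p (λ ks → a (head ks) /ₙ ∏ ks)
          -- The congruence is applied to the outer index only, where 0 < k is available:
          -- `b (k ∸ 1)` agrees with `a k` over k only for positive k.
          ≡⟨ sumBetween-cong 0 p head-term ⟩
        sumIncreasing (suc m) 0 p (λ ks → b (head ks ∸ 1) * recip (∏ (tail ks)))
          ≡⟨ sum-by-head m b ⟩
        ∑[ j < suc M ] (proj₁ (upper m (toℕ j)) * b (toℕ j))
          ≡⟨ weighted-residues (upper m) b ib ⟨
        proj₁ (weighted (upper m) (residues b ib)) ∎)
      c≋0 (upper≋0 b ib b∈𝒮₊)
      where
      open ≡-Reasoning
      b c : ℕ → ℚ
      b j = recip (suc j) * a (suc j)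
      c j = recip (suc M ∸ j) * a (suc j)
      b∈𝒮₊ : 𝒮₊ b
      b∈𝒮₊ = 𝒮₋⇒𝒮₊ a a∈𝒮₋
      ib : ∀ j → j ≤ M → p -integral b j
      ib j j≤M = integral-* p-prime {recip (suc j)} (integral-recip p-prime (s≤s z≤n) (s≤s (s≤s j≤M))) (ia (suc j) (s≤s j≤M))
      ic : ∀ j → j ≤ M → p -integral c j
      ic j j≤M = integral-* p-prime {recip (suc M ∸ j)}
        (integral-recip p-prime (ℕ.m<n⇒0<n∸m (s≤s j≤M)) (s≤s (ℕ.m∸n≤m (suc M) j))) (ia (suc j) (s≤s j≤M))
      split-last : ∀ (ks : Vec ℕ (suc m)) x → x /ₙ ∏ ks ≡ recip (last ks) * x * recip (∏ (init ks))
      split-last ks x = begin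
        x /ₙ ∏ ks                                  ≡⟨ /ₙ≡*recip x (∏ ks) ⟩
        x * recip (∏ ks)                           ≡⟨ cong (λ d → x * recip d) (∏-init-last ks) ⟩
        x * recip (∏ (init ks) ℕ.* last ks)        ≡⟨ cong (x *_) (recip-homo-* (∏ (init ks)) (last ks)) ⟩
        x * (recip (∏ (init ks)) * recip (last ks)) ≡⟨ solve 3 (λ x u v → x :* (u :* v) := v :* x :* u) refl x (recip (∏ (init ks))) (recip (last ks)) ⟩
        recip (last ks) * x * recip (∏ (init ks))  ∎
      head-term : ∀ k → 0 < k → k < p →
        sumIncreasing m k p (λ ks → a k /ₙ (k ℕ.* ∏ ks)) ≡ sumIncreasing m k p (λ ks → b (k ∸ 1) * recip (∏ ks))
      head-term (suc k) _ _ = sumIncreasing-cong m (suc k) p (λ ks → begin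
        a (suc k) /ₙ (suc k ℕ.* ∏ ks)               ≡⟨ /ₙ≡*recip (a (suc k)) (suc k ℕ.* ∏ ks) ⟩
        a (suc k) * recip (suc k ℕ.* ∏ ks)          ≡⟨ cong (a (suc k) *_) (recip-homo-* (suc k) (∏ ks)) ⟩
        a (suc k) * (recip (suc k) * recip (∏ ks))  ≡⟨ solve 3 (λ x u v → x :* (u :* v) := u :* x :* v) refl (a (suc k)) (recip (suc k)) (recip (∏ ks)) ⟩
        recip (suc k) * a (suc k) * recip (∏ ks)    ∎)
      -- 1/(p − k) ≡ −1/k modulo p
      c⊕b≋0 : ∀ j → (residues c ic j ⊕ residues b ib j) ≋ 0#
      c⊕b≋0 j = congruent (y * w * x)
        (integral-* p-prime {y * w} {x} (integral-* p-prime {y} {w}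
          (integral-recip p-prime (s≤s z≤n) (s≤s (s≤s (ℕ.m∸n≤m M i))))
          (integral-recip p-prime (s≤s z≤n) (s≤s (s≤s i≤M)))) (ia (suc i) (s≤s i≤M)))
        (begin
        recip (suc M ∸ i) * x + w * x - 0ℚ
          ≡⟨ cong (λ d → recip d * x + w * x - 0ℚ) (ℕ.+-∸-assoc 1 i≤M) ⟩
        y * x + w * x - 0ℚ
          ≡⟨ solve 3 (λ y w x → y :* x :+ w :* x :- con 0ℚ := (y :+ w) :* x) refl y w x ⟩
        (y + w) * x
          ≡⟨ cong (_* x) (recip-+ (M ∸ i) i) ⟩
        ⟦ suc (M ∸ i) ℕ.+ suc i ⟧ * (y * w) * x
          ≡⟨ cong (λ d → ⟦ d ⟧ * (y * w) * x) (cong suc (trans (ℕ.+-suc (M ∸ i) i) (cong suc (ℕ.m∸n+n≡m i≤M)))) ⟩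
        ⟦ p ⟧ * (y * w) * x
          ≡⟨ *-assoc ⟦ p ⟧ (y * w) x ⟩
        ⟦ p ⟧ * (y * w * x) ∎)
        where
        i = j ⊓ M
        i≤M : i ≤ M
        i≤M = ℕ.m⊓n≤n j M
        x = a (suc i)
        y = recip (suc (M ∸ i))
        w = recip (suc i)
      -- Invariance is known for `b`, while `c` is merely congruent to -`b`. Adding the sum for `b`,
      -- which already vanishes, makes every term cancel.
      c≋0 : weighted (lower m) (residues c ic) ≋ 0#
      c≋0 = ≋-trans (≋-sym (⊕-identityʳ (weighted (lower m) (residues c ic))))
        (≋-trans (⊕-congˡ {weighted (lower m) (residues c ic)} (≋-sym (lower≋0 b ib b∈𝒮₊)))
        (≋-trans (≋-sym (𝔽∑.∑-distrib-+ {suc M} (λ j → lower m (toℕ j) ⊗ residues c ic (toℕ j)) (λ j → lower m (toℕ j) ⊗ residues b ib (toℕ j))))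
        (𝔽∑.∑-zero (λ j → (lower m j ⊗ residues c ic j) ⊕ (lower m j ⊗ residues b ib j)) (suc M) (λ j _ →
          ≋-trans (≋-sym (⊗-distribˡ-⊕ (lower m j) (residues c ic j) (residues b ib j)))
            (≋-trans (⊗-congˡ {lower m j} (c⊕b≋0 j)) (⊗-zeroʳ (lower m j)))))))

odd-prime : ∀ {p} → Prime p → 2 < p → ¬ (2 ∣ p)
odd-prime p-prime 2<p 2∣p = [ (λ ()) , (λ 2≡p → ℕ.<⇒≢ 2<p 2≡p) ]′ (prime⇒irreducible p-prime 2∣p)

corollary1p2 : ∀ (m p : ℕ) → let n = suc m in
    ¬ (2 ∣ n) → Prime p → n ℕ.+ 1 < p →
    ((a : ℕ → ℚ) → 𝒮₋ a → (∀ k → k ≤ p ∸ 1 → p -integral a k) →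
      let A = sumIncreasing n 0 p (λ ks → a (p ∸ last ks) /ₙ ∏ ks)
          B = sumIncreasing n 0 p (λ ks → a (head ks) /ₙ ∏ ks)
      in (A ≡ B [mod p ]) × (B ≡ 0ℚ [mod p ]))
    ×
    ((a : ℕ → ℚ) → 𝒮₊ a → (∀ k → k ≤ p ∸ 2 → p -integral a k) →
      let A = sumIncreasing n 0 p (λ ks → a (p ∸ last ks ∸ 1) /ₙ ∏ (init ks))
          B = sumIncreasing n 0 p (λ ks → a (head ks ∸ 1) /ₙ ∏ (tail ks))
      in (A ≡ B [mod p ]) × (B ≡ 0ℚ [mod p ]))
corollary1p2 m (suc zero) 2∤n p-prime (s≤s ())
-- As n ≥ 1, the bound n + 1 < p forces p > 2. Then p - 1 = t + t fixes the sign at the top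
-- coefficient, and 0 < M makes 2 cancellable.
corollary1p2 m (suc (suc M)) 2∤n p-prime n+1<p with odd⇒half m 2∤n | odd⇒half (suc M) (odd-prime p-prime 2<p)
  where
  2<p : 2 < 2 ℕ.+ M
  2<p = ℕ.≤-<-trans (s≤s (ℕ.m≤n+m 1 m)) n+1<p
... | u , refl | t , odd = case₋ p-prime {t} odd 0<M u , case₊ p-prime {t} odd 0<M u
  where
  0<M : 0 < M
  0<M = ℕ.≤-pred (ℕ.≤-pred (ℕ.≤-<-trans (s≤s (ℕ.m≤n+m 1 m)) n+1<p))
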